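{- For all integers $n>0$ and $k>0$, \[ |\mathcal{C}_n^k|=\sum_{m=0}^{\min(n,k)}\sum_{i=0}^{n}\sum_{j=0}^{k}\left\langle n\atop i\right\rangle\left\langle k\atop j\right\rangle\binom{n+1-i}{m+1-i}\binom{k+1-j}{m+1-j}=B_{n,k}. \]
   Context: A Callan permutation of $[n+k]=\{1,2,\ldots,n+k\}$ is a permutation (written as a word $\pi_1\pi_2\cdots\pi_{n+k}$) such that every substring of consecutive entries all of whose entries lie in $N=\{1,\ldots,n\}$, or all of whose entries lie in $K=\{n+1,\ldots,n+k\}$, is increasing. $\mathcal{C}_n^k$ denotes the set of Callan permutations of $[n+k]$. The poly-Bernoulli numbers are defined by $\sum_{n\ge 0}B_n^{(k)}\frac{x^n}{n!}=\frac{\mathrm{Li}_k(1-e^{ -x})}{1-e^{ -x}}$ with $\mathrm{Li}_k(z)=\sum_{i\ge1} z^i/i^k$, and $B_{n,k}:=B_n^{(-k)}$. The Eulerian number $\left\langle k\atop j\right\rangle$ is the number of permutations of $[k]$ with exactly $j-1$ descents (equivalently, with $j$ maximal ascending runs); in particular $\left\langle k\atop 0\right\rangle=0$ for $k>0$. Binomial coefficients $\binom{a}{b}$ with $b<0$ or $b>a\ge 0$ are $0$. -}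

module Defs where

open import Data.Nat as ℕ using (ℕ; zero; suc; _+_; _*_; _<_; _≤_; _>_; _⊓_; _!)
open import Data.Nat.Properties using (_<?_; _≤?_; _≟_; _!≢0)
open import Data.Nat.Combinatorics using (_C_)
open import Data.Integer as ℤ using (ℤ; +_; -[1+_])
open import Data.Rational as ℚ using (ℚ)
open import Data.List using (List; []; _∷_; length; filter; applyUpTo; concatMap; inits; tails; map; upTo)
open import Data.Nat.ListAction using (sum)
open import Data.List.Relation.Unary.All using (All; all?)
open import Data.List.Relation.Unary.Linked using (Linked; linked?)
open import Data.List.Relation.Unary.AllPairs using (AllPairs; allPairs?)
open import Data.Product using (_×_)
open import Data.Sum using (_⊎_)
open import Relation.Nullary using (Dec; yes; no; ¬_; ¬?; _×-dec_; _⊎-dec_; _→-dec_)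
open import Relation.Binary.PropositionalEquality using (_≡_; _≢_)

words : ℕ → ℕ → List (List ℕ)
words N zero    = [] ∷ []
words N (suc l) = concatMap (λ a → map (a ∷_) (words N l)) (applyUpTo suc N)

Distinct : List ℕ → Set
Distinct = AllPairs _≢_

distinct? : (w : List ℕ) → Dec (Distinct w)
distinct? = allPairs? (λ x y → ¬? (x ≟ y))

perms : ℕ → List (List ℕ)
perms N = filter distinct? (words N N)

substrings : List ℕ → List (List ℕ)
substrings w = concatMap inits (tails w)

Increasing : List ℕ → Set
Increasing = Linked _<_

-- letters of N = {1,…,n} and of K = {n+1,…,n+k}
InN : ℕ → ℕ → Set
InN n a = a ≤ n

InK : ℕ → ℕ → Set
InK n a = n < a

CallanCondition : ℕ → List ℕ → Set
CallanCondition n π =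
  All (λ s → (All (InN n) s ⊎ All (InK n) s) → Increasing s) (substrings π)

callan? : (n : ℕ) (π : List ℕ) → Dec (CallanCondition n π)
callan? n π = all? (λ s → (all? (λ a → a ≤? n) s ⊎-dec all? (λ a → n <? a) s)
                          →-dec linked? _<?_ s) (substrings π)

callanPerms : ℕ → ℕ → List (List ℕ)
callanPerms n k = filter (callan? n) (perms (n + k))

numCallan : ℕ → ℕ → ℕ
numCallan n k = length (callanPerms n k)

-- Eulerian numbers: ⟨k j⟩ = # permutations of [k] with exactly j-1 descents
-- (so ⟨k 0⟩ = 0 for k > 0)

descents : List ℕ → ℕ
descents []       = 0
descents (x ∷ xs) = go x xs
  where
  go : ℕ → List ℕ → ℕ
  go x []       = 0
  go x (y ∷ ys) with y <? x
  ... | yes _ = suc (go y ys)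
  ... | no  _ = go y ys

eulerian : ℕ → ℕ → ℕ
eulerian k j = length (filter (λ π → suc (descents π) ≟ j) (perms k))

binomℤ : ℕ → ℤ → ℕ
binomℤ a (+ b)    = a C b
binomℤ a -[1+ _ ] = 0

Σ[0‥_] : ℕ → (ℕ → ℕ) → ℕ
Σ[0‥ m ] f = sum (map f (upTo (suc m)))

eulerianSum : ℕ → ℕ → ℕ
eulerianSum n k =
  Σ[0‥ n ⊓ k ] λ m → Σ[0‥ n ] λ i → Σ[0‥ k ] λ j →
    eulerian n i * eulerian k j
      * binomℤ (n + 1 ℕ.∸ i) ((+ (m + 1)) ℤ.- (+ i))
      * binomℤ (k + 1 ℕ.∸ j) ((+ (m + 1)) ℤ.- (+ j))

-- Poly-Bernoulli numbers via their generating function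
-- Σ_n B_n^{(-k)} xⁿ/n! = Li_{-k}(1-e^{-x}) / (1-e^{-x}) = Σ_{i≥1} i^k (1-e^{-x})^{i-1},
-- computed with formal power series over ℚ (coefficient sequences).

Series : Set
Series = ℕ → ℚ

ΣQ[0‥_] : ℕ → (ℕ → ℚ) → ℚ
ΣQ[0‥ zero  ] f = f 0
ΣQ[0‥ suc m ] f = ΣQ[0‥ m ] f ℚ.+ f (suc m)

_⋆_ : Series → Series → Series
(a ⋆ b) n = ΣQ[0‥ n ] λ j → a j ℚ.* b (n ℕ.∸ j)

oneS : Series
oneS zero    = ℚ.1ℚ
oneS (suc _) = ℚ.0ℚ

_^S_ : Series → ℕ → Series
f ^S zero  = oneS
f ^S suc e = f ⋆ (f ^S e)

inv! : ℕ → ℚ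
inv! j = (+ 1) ℚ./ (j !)
  where instance _ = j !≢0

expNeg : Series
expNeg j = sign j ℚ.* inv! j
  where
  sign : ℕ → ℚ
  sign zero          = ℚ.1ℚ
  sign (suc zero)    = ℚ.- ℚ.1ℚ
  sign (suc (suc t)) = sign t

oneMinusExpNeg : Series
oneMinusExpNeg j = oneS j ℚ.- expNeg j

-- B_n^{(-k)}: since (1-e^{-x})^{i-1} = O(x^{i-1}), only i ≤ n+1 contribute to xⁿ.
polyBernoulli : ℕ → ℕ → ℚ
polyBernoulli n k =
  (+ (n !) ℚ./ 1) ℚ.*
    ΣQ[0‥ n ] (λ i → (+ (suc i ℕ.^ k) ℚ./ 1) ℚ.* (oneMinusExpNeg ^S i) n)

B : ℕ → ℕ → ℚ
B n k = polyBernoulli n k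

-- Callan words, permutations with marked cuts and the powers (x + 1)ᵏ all expand in one array:
-- let T a b r be the coefficient of C(x, r) in xᵃ (x + 1)ᵇ. Reading a permutation letter by letter,
-- what matters about the unused letters is only how many lie below and above the last letter,
-- so both counts satisfy a first-letter recursion over such pairs, and Pascal's rule
-- T a (b+1) r = T (a+1) b r + T a b r makes these recursions telescope. An extra letter 0 in front
-- treats the first letter like any other. This gives
--   Σᵢ ⟨n i⟩ C(n+1-i, m+1-i) = T 0 n m   and   |𝒞ₙᵏ| = Σₘ T 0 n m · T 0 k m.
-- For the poly-Bernoulli side put P n i = n! [xⁿ] (1 - e⁻ˣ)ⁱ. Differentiation yields
-- P (n+1) (i+1) = (i+1) (P n i - P n (i+1)), whence Σᵢ P n i · C(i, m) = T 0 n m;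
-- insert (i+1)ᵏ = Σₘ C(i, m) · T 0 k m into B n k = Σᵢ P n i · (i+1)ᵏ.
module Submission where

open import Defs
open import Algebra.Bundles using (CommutativeRing; CommutativeSemiring)
import Algebra.Properties.CommutativeSemigroup as CommutativeSemigroupProperties
open import Data.Bool using (true; false; if_then_else_)
import Data.Integer as ℤ
open ℤ using (_⊖_)
import Data.Integer.Properties as ℤ
open import Data.List using (List; []; _∷_; _++_; map; length; filter; applyUpTo; concatMap; inits)
open import Data.List.Membership.Propositional using (_∈_; _∉_)
open import Data.List.Membership.Propositional.Properties using (∈-++⁺ˡ; ∈-++⁺ʳ; ∈-++⁻)
open import Data.List.Properties using (map-++; length-++; length-applyUpTo; ++-assoc)
open import Data.List.Relation.Unary.All as All using (All; []; _∷_; all?)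
import Data.List.Relation.Unary.All.Properties as All
open import Data.List.Relation.Unary.AllPairs as AllPairs using (AllPairs; []; _∷_)
import Data.List.Relation.Unary.AllPairs.Properties as AllPairs
open import Data.List.Relation.Unary.Any using (here; there)
open import Data.List.Relation.Unary.Linked using (Linked; []; [-]; _∷_; linked?)
open import Data.Nat hiding (_/_)
open import Data.Nat.Combinatorics using (_C_; nCk+nC[k+1]≡[n+1]C[k+1]; k>n⇒nCk≡0)
open import Data.Nat.ListAction using (sum)
open import Data.Nat.ListAction.Properties using (sum-++)
open import Data.Nat.Properties
open import Data.Nat.Tactic.RingSolver using (solve-∀)
open import Data.List.Membership.DecPropositional _≟_ using (_∈?_)
open import Data.Product using (_×_; _,_; proj₁; proj₂)
open import Data.Rational as ℚ using (ℚ; 0ℚ; 1ℚ; _/_)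
import Data.Rational.Properties as ℚ
open import Data.Rational.Solver using (module +-*-Solver)
import Data.Rational.Unnormalised as ℚᵘ
open ℚᵘ using (mkℚᵘ; *≡*)
import Data.Rational.Unnormalised.Properties as ℚᵘ
open import Algebra.Properties.Group ℚ.+-0-group using () renaming (∙-cancelʳ to ℚ-cancelʳ)
open import Data.Sum using (_⊎_; inj₁; inj₂)
open import Function using (_∘_; id; _⇔_; mk⇔)
open import Relation.Binary.PropositionalEquality
import Relation.Binary.Reasoning.Setoid as SetoidReasoning
open import Relation.Nullary
open import Relation.Nullary.Decidable using (does-⇔; dec-true; dec-false)

-- Finite sums over a commutative semiring, used over both ℕ and ℚ

module FiniteSum {c ℓ} (R : CommutativeSemiring c ℓ) where
  private module R = CommutativeSemiring R
  open R using (Carrier; _≈_; 0#)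
    renaming (_+_ to _⊕_; _*_ to _⊛_; refl to ≈-refl; sym to ≈-sym; trans to ≈-trans)
  open CommutativeSemigroupProperties R.+-commutativeSemigroup using (interchange)

  Σ≤ : ℕ → (ℕ → Carrier) → Carrier
  Σ≤ zero    f = f 0
  Σ≤ (suc n) f = Σ≤ n f ⊕ f (suc n)

  Σ≤-cong : ∀ n {f g} → (∀ i → i ≤ n → f i ≈ g i) → Σ≤ n f ≈ Σ≤ n g
  Σ≤-cong zero    f≈g = f≈g 0 z≤n
  Σ≤-cong (suc n) f≈g =
    R.+-cong (Σ≤-cong n λ i i≤n → f≈g i (m≤n⇒m≤1+n i≤n)) (f≈g (suc n) ≤-refl)

  Σ≤-+ : ∀ n f g → Σ≤ n (λ i → f i ⊕ g i) ≈ Σ≤ n f ⊕ Σ≤ n g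
  Σ≤-+ zero    f g = ≈-refl
  Σ≤-+ (suc n) f g = ≈-trans (R.+-congʳ (Σ≤-+ n f g)) (interchange _ _ _ _)

  Σ≤-*ˡ : ∀ n x f → Σ≤ n (λ i → x ⊛ f i) ≈ x ⊛ Σ≤ n f
  Σ≤-*ˡ zero    x f = ≈-refl
  Σ≤-*ˡ (suc n) x f = ≈-trans (R.+-congʳ (Σ≤-*ˡ n x f)) (≈-sym (R.distribˡ x _ _))

  Σ≤-*ʳ : ∀ n x f → Σ≤ n (λ i → f i ⊛ x) ≈ Σ≤ n f ⊛ x
  Σ≤-*ʳ zero    x f = ≈-refl
  Σ≤-*ʳ (suc n) x f = ≈-trans (R.+-congʳ (Σ≤-*ʳ n x f)) (≈-sym (R.distribʳ x _ _))

  Σ≤-swap : ∀ m n (f : ℕ → ℕ → Carrier) → Σ≤ m (λ i → Σ≤ n (f i)) ≈ Σ≤ n (λ j → Σ≤ m (λ i → f i j))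
  Σ≤-swap zero    n f = ≈-refl
  Σ≤-swap (suc m) n f = ≈-trans (R.+-congʳ (Σ≤-swap m n f)) (≈-sym (Σ≤-+ n _ _))

  Σ≤-head : ∀ n f → Σ≤ (suc n) f ≈ f 0 ⊕ Σ≤ n (λ i → f (suc i))
  Σ≤-head zero    f = ≈-refl
  Σ≤-head (suc n) f = ≈-trans (R.+-congʳ (Σ≤-head n f)) (R.+-assoc _ _ _)

  Σ≤-extend : ∀ n m {f} → n ≤ m → (∀ i → n < i → f i ≈ 0#) → Σ≤ n f ≈ Σ≤ m f
  Σ≤-extend n m {f} n≤m f≈0 = go (≤⇒≤′ n≤m)
    where
    go : ∀ {m} → n ≤′ m → Σ≤ n f ≈ Σ≤ m f
    go ≤′-refl         = ≈-refl
    go (≤′-step n≤′m) = ≈-trans (go n≤′m)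
      (≈-sym (≈-trans (R.+-congˡ (f≈0 _ (s≤s (≤′⇒≤ n≤′m)))) (R.+-identityʳ _)))

  -- The shift trades the term at 0 for the term at `n + 1`, and both vanish. This is how sums
  -- telescope here without subtraction.
  Σ≤-shift : ∀ n f → f 0 ≈ 0# → f (suc n) ≈ 0# → Σ≤ n (λ i → f (suc i)) ≈ Σ≤ n f
  Σ≤-shift n f f0≈0 f1+n≈0 = begin
    Σ≤ n (λ i → f (suc i))       ≈⟨ R.+-identityˡ _ ⟨
    0# ⊕ Σ≤ n (λ i → f (suc i))  ≈⟨ R.+-congʳ f0≈0 ⟨
    f 0 ⊕ Σ≤ n (λ i → f (suc i)) ≈⟨ Σ≤-head n f ⟨
    Σ≤ n f ⊕ f (suc n)           ≈⟨ R.+-congˡ f1+n≈0 ⟩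
    Σ≤ n f ⊕ 0#                  ≈⟨ R.+-identityʳ _ ⟩
    Σ≤ n f                       ∎
    where open SetoidReasoning R.setoid

open FiniteSum +-*-commutativeSemiring
module Q = FiniteSum (CommutativeRing.commutativeSemiring ℚ.+-*-commutativeRing)
open CommutativeSemigroupProperties +-commutativeSemigroup using (interchange; x∙yz≈y∙xz)
open ≡-Reasoning

-- Splitting sums and the array `T`

-- Σsplit h b = Σ h t u over t + u + 1 = b: some letter is taken out of b letters, leaving t below and u above it.
Σsplit : (ℕ → ℕ → ℕ) → ℕ → ℕ
Σsplit h zero    = 0
Σsplit h (suc b) = h 0 b + Σsplit (λ t → h (suc t)) b

Σsplit-+ : ∀ g h b → Σsplit (λ t u → g t u + h t u) b ≡ Σsplit g b + Σsplit h b
Σsplit-+ g h zero    = refl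
Σsplit-+ g h (suc b) rewrite Σsplit-+ (λ t → g (suc t)) (λ t → h (suc t)) b =
  interchange (g 0 b) _ _ _

Σsplit-concat : ∀ h a b →
  Σsplit h (a + b) ≡ Σsplit (λ t u → h t (u + b)) a + Σsplit (λ t u → h (a + t) u) b
Σsplit-concat h zero    b = refl
Σsplit-concat h (suc a) b =
  trans (cong (h 0 (a + b) +_) (Σsplit-concat (λ t → h (suc t)) a b)) (sym (+-assoc (h 0 (a + b)) _ _))

-- By the hypothesis each term `h t u` is the difference of `h t (u + 1)` and `h (t + 1) u`, two
-- neighbours on one antidiagonal; only its two ends survive.
Σsplit-telescope : ∀ h → (∀ t u → h t (suc u) ≡ h (suc t) u + h t u) →
                   ∀ b → Σsplit h b + h b 0 ≡ h 0 b
Σsplit-telescope h pascal zero    = refl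
Σsplit-telescope h pascal (suc b) = begin
  h 0 b + S + h (suc b) 0   ≡⟨ +-assoc (h 0 b) S _ ⟩
  h 0 b + (S + h (suc b) 0) ≡⟨ cong (h 0 b +_) (Σsplit-telescope (λ t → h (suc t)) (λ t → pascal (suc t)) b) ⟩
  h 0 b + h 1 b             ≡⟨ +-comm (h 0 b) (h 1 b) ⟩
  h 1 b + h 0 b             ≡⟨ pascal 0 b ⟨
  h 0 (suc b)               ∎
  where
  S = Σsplit (λ t → h (suc t)) b

-- The recursions come from x C(x, r) = r C(x, r) + (r+1) C(x, r+1). Combinatorially, T a b r counts the
-- ways to continue a block whose last letter has a unused letters below it and b above it,
-- using up all of these letters and opening exactly r further increasing blocks.
T : ℕ → ℕ → ℕ → ℕ
T zero    zero    zero    = 1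
T zero    zero    (suc r) = 0
T zero    (suc b) zero    = T zero b zero
T zero    (suc b) (suc r) = suc (suc r) * T zero b (suc r) + suc r * T zero b r
T (suc a) b       zero    = 0
T (suc a) b       (suc r) = suc r * (T a b (suc r) + T a b r)

T-pascal : ∀ a b r → T a (suc b) r ≡ T (suc a) b r + T a b r
T-pascal zero    b zero    = refl
T-pascal zero    b (suc r) = ring r (T 0 b (suc r)) (T 0 b r)
  where
  ring : ∀ r x y → suc (suc r) * x + suc r * y ≡ suc r * (x + y) + x
  ring = solve-∀
T-pascal (suc a) b zero    = refl
T-pascal (suc a) b (suc r) rewrite T-pascal a b (suc r) | T-pascal a b r =
  ring (suc r) (T (suc a) b (suc r)) (T a b (suc r)) (T (suc a) b r) (T a b r)
  where
  ring : ∀ s x y z w → s * (x + y + (z + w)) ≡ s * (x + z) + s * (y + w)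
  ring = solve-∀

-- Substitute `x + 1` for `x` in the expansion of `xᵇ` and use
-- `C(x + 1, r) = C(x, r) + C(x, r - 1)`.
T-open : ∀ b r → T 0 b r ≡ T b 0 r + T b 0 (suc r)
T-open zero    zero    = refl
T-open zero    (suc r) = refl
T-open (suc b) zero    rewrite T-open b zero = ring (T b 0 0) (T b 0 1)
  where
  ring : ∀ x y → x + y ≡ y + x + 0
  ring = solve-∀
T-open (suc b) (suc r) rewrite T-open b (suc r) | T-open b r =
  ring r (T b 0 r) (T b 0 (suc r)) (T b 0 (suc (suc r)))
  where
  ring : ∀ r x y z → suc (suc r) * (y + z) + suc r * (x + y) ≡ suc r * (y + x) + suc (suc r) * (z + y)
  ring = solve-∀

-- The polynomial `xᵃ (x + 1)ᵇ` has degree `a + b`.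
T-vanish : ∀ a b r → a + b < r → T a b r ≡ 0
T-vanish zero    zero    (suc r) _         = refl
T-vanish zero    (suc b) (suc r) (s≤s b<r)
  rewrite T-vanish 0 b r b<r | T-vanish 0 b (suc r) (m<n⇒m<1+n b<r) = ring r
  where
  ring : ∀ r → suc (suc r) * 0 + suc r * 0 ≡ 0
  ring = solve-∀
T-vanish (suc a) b       (suc r) (s≤s a+b<r)
  rewrite T-vanish a b r a+b<r | T-vanish a b (suc r) (m<n⇒m<1+n a+b<r) = *-zeroʳ (suc r)

-- As polynomials: `xᵃ ((x + 1)ᵇ - xᵇ)` is the sum of `xᵃ⁺ᵗ (x + 1)ᵘ` over `t + u + 1 = b`.
T-extend : ∀ a b r → Σsplit (λ t u → T (a + t) u r) b + T (a + b) 0 r ≡ T a b r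
T-extend a b r = trans
  (Σsplit-telescope (λ t u → T (a + t) u r) pascal b)
  (cong (λ a → T a b r) (+-identityʳ a))
  where
  pascal : ∀ t u → T (a + t) (suc u) r ≡ T (a + suc t) u r + T (a + t) u r
  pascal t u rewrite +-suc a t = T-pascal (a + t) u r

T-newBlock : ∀ c r → Σsplit (λ t u → T t u r) c ≡ T c 0 (suc r)
T-newBlock c r = +-cancelʳ-≡ (T c 0 r) _ _ (begin
  Σsplit (λ t u → T t u r) c + T c 0 r ≡⟨ T-extend 0 c r ⟩
  T 0 c r                              ≡⟨ T-open c r ⟩
  T c 0 r + T c 0 (suc r)              ≡⟨ +-comm (T c 0 r) _ ⟩
  T c 0 (suc r) + T c 0 r              ∎)

T-rec-zero : ∀ a b → 0 < a + b → Σsplit (λ t u → T (a + t) u 0) b ≡ T a b 0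
T-rec-zero a b 0<a+b = begin
  S                  ≡⟨ +-identityʳ S ⟨
  S + 0              ≡⟨ cong (S +_) (closed (a + b) 0<a+b) ⟨
  S + T (a + b) 0 0  ≡⟨ T-extend a b 0 ⟩
  T a b 0            ∎
  where
  S = Σsplit (λ t u → T (a + t) u 0) b
  closed : ∀ c → 0 < c → T c 0 0 ≡ 0
  closed (suc c) _ = refl

-- A lower letter must open a new block, a higher one may open a block or continue the current one.
-- The openings together run over all `a + b` letters and add up to `T (a + b) 0 (suc r)`, the
-- closing term that `T-extend` asks for.
T-rec-suc : ∀ a b r →
  Σsplit (λ t u → T t (u + b) r) a + Σsplit (λ t u → T (a + t) u (suc r) + T (a + t) u r) b
    ≡ T a b (suc r)
T-rec-suc a b r = begin
  L + Σsplit (λ t u → T (a + t) u (suc r) + T (a + t) u r) b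
    ≡⟨ cong (L +_) (Σsplit-+ (λ t u → T (a + t) u (suc r)) (λ t u → T (a + t) u r) b) ⟩
  L + (H + H′)
    ≡⟨ x∙yz≈y∙xz L H H′ ⟩
  H + (L + H′)
    ≡⟨ cong (H +_) (Σsplit-concat (λ t u → T t u r) a b) ⟨
  H + Σsplit (λ t u → T t u r) (a + b)
    ≡⟨ cong (H +_) (T-newBlock (a + b) r) ⟩
  H + T (a + b) 0 (suc r)
    ≡⟨ T-extend a b (suc r) ⟩
  T a b (suc r) ∎
  where
  L  = Σsplit (λ t u → T t (u + b) r) a
  H  = Σsplit (λ t u → T (a + t) u (suc r)) b
  H′ = Σsplit (λ t u → T (a + t) u r) b

-- Counting Callan continuations by `X`

-- After a letter of one colour with a unused letters of that colour below it and b above it, and q unused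
-- letters of the other colour, X counts the Callan continuations; any R ≥ a + b + q serves as a summation bound.
X : ℕ → ℕ → ℕ → ℕ → ℕ
X R a b q = Σ≤ R λ m → T a b m * T 0 q m

X-pascal : ∀ R a b q → X R a (suc b) q ≡ X R (suc a) b q + X R a b q
X-pascal R a b q = trans
  (Σ≤-cong R λ m _ → trans (cong (_* T 0 q m) (T-pascal a b m)) (*-distribʳ-+ (T 0 q m) (T (suc a) b m) (T a b m)))
  (Σ≤-+ R _ _)

X-extend : ∀ R a b q → Σsplit (λ t u → X R (a + t) u q) b + X R (a + b) 0 q ≡ X R a b q
X-extend R a b q = trans
  (Σsplit-telescope (λ t u → X R (a + t) u q) pascal b)
  (cong (λ a → X R a b q) (+-identityʳ a))
  where
  pascal : ∀ t u → X R (a + t) (suc u) q ≡ X R (a + suc t) u q + X R (a + t) u q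
  pascal t u rewrite +-suc a t = X-pascal R (a + t) u q

-- Once `T-open` has rewritten each `T 0 _ m`, the summands of the two sides differ by
-- `D m - D (suc m)`, and `D` vanishes at 0 and at `suc R`.
X-closed : ∀ R c q → 0 < c + q → c + q ≤ R → X R c 0 q + X R q 0 c ≡ X R 0 q c
X-closed R c q 0<c+q c+q≤R = +-cancelʳ-≡ (Σ≤ R D) _ _ (begin
  X R c 0 q + X R q 0 c + Σ≤ R D
    ≡⟨ cong₂ _+_ (Σ≤-+ R _ _) D-shift ⟨
  Σ≤ R (λ m → T c 0 m * T 0 q m + T q 0 m * T 0 c m) + Σ≤ R (λ m → D (suc m))
    ≡⟨ Σ≤-+ R _ _ ⟨
  Σ≤ R (λ m → T c 0 m * T 0 q m + T q 0 m * T 0 c m + D (suc m))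
    ≡⟨ Σ≤-cong R (λ m _ → pointwise m) ⟩
  Σ≤ R (λ m → T 0 q m * T 0 c m + D m)
    ≡⟨ Σ≤-+ R _ _ ⟩
  X R 0 q c + Σ≤ R D ∎)
  where
  D : ℕ → ℕ
  D m = T c 0 m * T q 0 m

  -- Among the values `T c 0 0` only `T 0 0 0` is nonzero, so `0 < c + q` is what makes `D 0`
  -- vanish.
  D0 : ∀ c q → 0 < c + q → T c 0 0 * T q 0 0 ≡ 0
  D0 zero    (suc q) _ = refl
  D0 (suc c) q       _ = refl

  D-top : D (suc R) ≡ 0
  D-top = cong (_* T q 0 (suc R)) (T-vanish c 0 (suc R) (s≤s
    (≤-trans (≤-reflexive (+-identityʳ c)) (≤-trans (m≤m+n c q) c+q≤R))))

  D-shift : Σ≤ R (λ m → D (suc m)) ≡ Σ≤ R D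
  D-shift = Σ≤-shift R D (D0 c q 0<c+q) D-top

  pointwise : ∀ m → T c 0 m * T 0 q m + T q 0 m * T 0 c m + D (suc m) ≡ T 0 q m * T 0 c m + D m
  pointwise m rewrite T-open q m | T-open c m =
    ring (T c 0 m) (T c 0 (suc m)) (T q 0 m) (T q 0 (suc m))
    where
    ring : ∀ x x′ y y′ → x * (y + y′) + y * (x + x′) + x′ * y′ ≡ (y + y′) * (x + x′) + x * y
    ring = solve-∀

-- The next letter is either a higher one of the same colour or any letter of the other colour, for
-- which the `a + b` letters left behind become the other colour.
X-rec : ∀ R a b q → 0 < a + b + q → a + b + q ≤ R →
  Σsplit (λ t u → X R (a + t) u q) b + Σsplit (λ t u → X R t u (a + b)) q ≡ X R a b q
X-rec R a b q 0<a+b+q a+b+q≤R = begin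
  H + Σsplit (λ t u → X R t u c) q ≡⟨ cong (H +_) switch ⟩
  H + X R c 0 q                    ≡⟨ X-extend R a b q ⟩
  X R a b q                        ∎
  where
  c = a + b
  H = Σsplit (λ t u → X R (a + t) u q) b
  -- With `X R q 0 c` added, both sides equal `X R 0 q c`: the left one by telescoping, the right
  -- one by `X-closed`.
  switch : Σsplit (λ t u → X R t u c) q ≡ X R c 0 q
  switch = +-cancelʳ-≡ (X R q 0 c) _ _
    (trans (X-extend R 0 q c) (sym (X-closed R c q 0<a+b+q a+b+q≤R)))

private variable
  A A′ : Set

-- Sums over permutations

∑ : (A → ℕ) → List A → ℕ
∑ f xs = sum (map f xs)

∑-cong : ∀ {f g : A → ℕ} {xs} → All (λ x → f x ≡ g x) xs → ∑ f xs ≡ ∑ g xs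
∑-cong []          = refl
∑-cong (fx≡gx ∷ e) = cong₂ _+_ fx≡gx (∑-cong e)

∑-+ : ∀ (f g : A → ℕ) xs → ∑ (λ x → f x + g x) xs ≡ ∑ f xs + ∑ g xs
∑-+ f g []       = refl
∑-+ f g (x ∷ xs) = trans (cong (f x + g x +_) (∑-+ f g xs)) (interchange (f x) _ _ _)

∑-0 : ∀ {f : A → ℕ} {xs} → All (λ x → f x ≡ 0) xs → ∑ f xs ≡ 0
∑-0 []         = refl
∑-0 (fx≡0 ∷ e) = cong₂ _+_ fx≡0 (∑-0 e)

∑-++ : ∀ (f : A → ℕ) xs ys → ∑ f (xs ++ ys) ≡ ∑ f xs + ∑ f ys
∑-++ f xs ys = trans (cong sum (map-++ f xs ys)) (sum-++ (map f xs) (map f ys))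

∑-map : ∀ (f : A′ → ℕ) (g : A → A′) xs → ∑ f (map g xs) ≡ ∑ (f ∘ g) xs
∑-map f g []       = refl
∑-map f g (x ∷ xs) = cong (f (g x) +_) (∑-map f g xs)

∑-concatMap : ∀ (f : A′ → ℕ) (g : A → List A′) xs → ∑ f (concatMap g xs) ≡ ∑ (λ x → ∑ f (g x)) xs
∑-concatMap f g []       = refl
∑-concatMap f g (x ∷ xs) = trans (∑-++ f (g x) _) (cong (∑ f (g x) +_) (∑-concatMap f g xs))

⟦_⟧ : {P : Set} → Dec P → ℕ
⟦ p? ⟧ = if does p? then 1 else 0

⟦⟧-cong : {P Q : Set} → P ⇔ Q → (p? : Dec P) (q? : Dec Q) → ⟦ p? ⟧ ≡ ⟦ q? ⟧
⟦⟧-cong P⇔Q p? q? = cong (λ b → if b then 1 else 0) (does-⇔ P⇔Q p? q?)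

⟦⟧-no : {P : Set} (p? : Dec P) → ¬ P → ⟦ p? ⟧ ≡ 0
⟦⟧-no (yes p) ¬p = contradiction p ¬p
⟦⟧-no (no _)  _  = refl

∑-filter : ∀ {P : A → Set} (P? : ∀ x → Dec (P x)) f xs →
           ∑ f (filter P? xs) ≡ ∑ (λ x → ⟦ P? x ⟧ * f x) xs
∑-filter P? f []       = refl
∑-filter P? f (x ∷ xs) with does (P? x)
... | true  = cong₂ _+_ (sym (+-identityʳ (f x))) (∑-filter P? f xs)
... | false = ∑-filter P? f xs

length-filter : ∀ {P : A → Set} (P? : ∀ x → Dec (P x)) xs → length (filter P? xs) ≡ ∑ (⟦_⟧ ∘ P?) xs
length-filter P? []       = refl
length-filter P? (x ∷ xs) with does (P? x)
... | true  = cong suc (length-filter P? xs)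
... | false = length-filter P? xs

-- The arguments of `g` run over all factorisations `p ++ y ∷ q`. In a sorted list `p` and `q` hold
-- the letters below and above `y`, so a summand that depends only on their lengths turns the sum
-- into a `Σsplit`.
Σpick : (List ℕ → ℕ → List ℕ → ℕ) → List ℕ → ℕ
Σpick g []       = 0
Σpick g (y ∷ ys) = g [] y ys + Σpick (g ∘ (y ∷_)) ys

Σpick-cong : ∀ {g h} xs → (∀ p y q → xs ≡ p ++ y ∷ q → g p y q ≡ h p y q) → Σpick g xs ≡ Σpick h xs
Σpick-cong []       g≡h = refl
Σpick-cong (x ∷ xs) g≡h =
  cong₂ _+_ (g≡h [] x xs refl) (Σpick-cong xs λ p y q e → g≡h (x ∷ p) y q (cong (x ∷_) e))

Σpick-++ : ∀ g xs ys → Σpick g (xs ++ ys) ≡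
           Σpick (λ p y q → g p y (q ++ ys)) xs + Σpick (λ p y q → g (xs ++ p) y q) ys
Σpick-++ g []       ys = refl
Σpick-++ g (x ∷ xs) ys =
  trans (cong (g [] x (xs ++ ys) +_) (Σpick-++ (g ∘ (x ∷_)) xs ys)) (sym (+-assoc (g [] x (xs ++ ys)) _ _))

Σpick-length : ∀ h xs → Σpick (λ p _ q → h (length p) (length q)) xs ≡ Σsplit h (length xs)
Σpick-length h []       = refl
Σpick-length h (x ∷ xs) = cong (h 0 (length xs) +_) (Σpick-length (λ t → h (suc t)) xs)

Σpick-∑ : ∀ k xs → Σpick (λ _ y _ → k y) xs ≡ ∑ k xs
Σpick-∑ k []       = refl
Σpick-∑ k (x ∷ xs) = cong (k x +_) (Σpick-∑ k xs)

-- arr l f S sums f over all words of l distinct letters of S (the first argument serves as fuel).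
arr : ℕ → (List ℕ → ℕ) → List ℕ → ℕ
arr zero    f S = f []
arr (suc l) f S = Σpick (λ p y q → arr l (f ∘ (y ∷_)) (p ++ q)) S

arr-cong : ∀ l {f g} S → (∀ w → f w ≡ g w) → arr l f S ≡ arr l g S
arr-cong zero    S f≡g = f≡g []
arr-cong (suc l) S f≡g = Σpick-cong S λ p y q _ → arr-cong l (p ++ q) (λ w → f≡g (y ∷ w))

Σpick-+ : ∀ g h xs → Σpick (λ p y q → g p y q + h p y q) xs ≡ Σpick g xs + Σpick h xs
Σpick-+ g h []       = refl
Σpick-+ g h (x ∷ xs) =
  trans (cong (g [] x xs + h [] x xs +_) (Σpick-+ (g ∘ (x ∷_)) (h ∘ (x ∷_)) xs))
        (interchange (g [] x xs) _ _ _)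

Σpick-0 : ∀ xs → Σpick (λ _ _ _ → 0) xs ≡ 0
Σpick-0 []       = refl
Σpick-0 (x ∷ xs) = Σpick-0 xs

arr-+ : ∀ l f g S → arr l (λ w → f w + g w) S ≡ arr l f S + arr l g S
arr-+ zero    f g S = refl
arr-+ (suc l) f g S = trans (Σpick-cong S λ p y q _ → arr-+ l (f ∘ (y ∷_)) (g ∘ (y ∷_)) (p ++ q)) (Σpick-+ _ _ S)

arr-0 : ∀ l S → arr l (λ _ → 0) S ≡ 0
arr-0 zero    S = refl
arr-0 (suc l) S = trans (Σpick-cong S λ p y q _ → arr-0 l (p ++ q)) (Σpick-0 S)

∑-single : ∀ (k : ℕ → ℕ) {y L} → Distinct L → y ∈ L → ∑ (λ a → if does (a ≟ y) then k a else 0) L ≡ k y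
∑-single k {y} {a ∷ L} (a∉L ∷ _) (here refl) rewrite dec-true (a ≟ a) refl =
  trans (cong (k a +_) (∑-0 (All.map zero-off a∉L))) (+-identityʳ (k a))
  where
  zero-off : ∀ {b} → a ≢ b → (if does (b ≟ a) then k b else 0) ≡ 0
  zero-off {b} a≢b rewrite dec-false (b ≟ a) (a≢b ∘ sym) = refl
∑-single k {y} {a ∷ L} (a∉L ∷ uL) (there y∈L)
  rewrite dec-false (a ≟ y) (All.lookup a∉L y∈L) = ∑-single k uL y∈L

-- Induction on `S` with `L` fixed: `k₁` carries the value at the head `y`, which the distinct list
-- `L` meets exactly once, and the rest `k₂` is supported on the tail. The order of the letters in
-- `L` and `S` is irrelevant.
∑-support : ∀ (k : ℕ → ℕ) {L} S → Distinct L → Distinct S → All (_∈ L) S → (∀ a → a ∉ S → k a ≡ 0) →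
            ∑ k L ≡ ∑ k S
∑-support k {L} [] uL _ _ k≡0 = ∑-0 {xs = L} (All.universal (λ a → k≡0 a λ ()) L)
∑-support k {L} (y ∷ S) uL (y∉S ∷ uS) (y∈L ∷ S⊆L) k≡0 = begin
  ∑ k L                             ≡⟨ ∑-cong {xs = L} (All.universal split L) ⟩
  ∑ (λ a → k₁ a + k₂ a) L           ≡⟨ ∑-+ k₁ k₂ L ⟩
  ∑ k₁ L + ∑ k₂ L                   ≡⟨ cong₂ _+_ (∑-single k uL y∈L) (∑-support k₂ S uL uS S⊆L k₂≡0) ⟩
  k y + ∑ k₂ S                      ≡⟨ cong (k y +_) (∑-cong (All.map k₂≡k y∉S)) ⟩
  k y + ∑ k S                       ∎
  where
  k₁ k₂ : ℕ → ℕ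
  k₁ a = if does (a ≟ y) then k a else 0
  k₂ a = if does (a ≟ y) then 0 else k a
  split : ∀ a → k a ≡ k₁ a + k₂ a
  split a with does (a ≟ y)
  ... | true  = sym (+-identityʳ (k a))
  ... | false = refl
  k₂≡k : ∀ {a} → y ≢ a → k₂ a ≡ k a
  k₂≡k {a} y≢a rewrite dec-false (a ≟ y) (y≢a ∘ sym) = refl
  k₂≡0 : ∀ a → a ∉ S → k₂ a ≡ 0
  k₂≡0 a a∉S = byCases (a ≟ y)
    where
    byCases : Dec (a ≡ y) → k₂ a ≡ 0
    byCases (yes a≡y) rewrite dec-true (a ≟ y) a≡y = refl
    byCases (no a≢y) rewrite dec-false (a ≟ y) a≢y =
      k≡0 a λ { (here a≡y) → a≢y a≡y ; (there a∈S) → a∉S a∈S }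

Arranged : List ℕ → List ℕ → Set
Arranged S w = Distinct w × All (_∈ S) w

arranged? : ∀ S w → Dec (Arranged S w)
arranged? S w = distinct? w ×-dec all? (_∈? S) w

unique-split : ∀ p {y q} → Distinct (p ++ y ∷ q) → Distinct (p ++ q) × y ∉ p ++ q
unique-split []      (y∉q ∷ uq) = uq , λ y∈q → All.lookup y∉q y∈q refl
unique-split (x ∷ p) {y} {q} (x∉ ∷ u) =
  let u′ , y∉ = unique-split p u
      x∉p , x∉yq = All.++⁻ p x∉
  in All.++⁺ x∉p (All.tail x∉yq) ∷ u′ ,
     λ where
       (here y≡x)  → All.head x∉yq (sym y≡x)
       (there y∈) → y∉ y∈

∈-insert : ∀ p {y q} {x : ℕ} → x ∈ p ++ q → x ∈ p ++ y ∷ q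
∈-insert p x∈ with ∈-++⁻ p x∈
... | inj₁ x∈p = ∈-++⁺ˡ x∈p
... | inj₂ x∈q = ∈-++⁺ʳ p (there x∈q)

∈-delete : ∀ p {y q} {x : ℕ} → y ≢ x → x ∈ p ++ y ∷ q → x ∈ p ++ q
∈-delete p y≢x x∈ with ∈-++⁻ p x∈
... | inj₁ x∈p         = ∈-++⁺ˡ x∈p
... | inj₂ (here x≡y)  = contradiction (sym x≡y) y≢x
... | inj₂ (there x∈q) = ∈-++⁺ʳ p x∈q

arranged-∷ : ∀ p y q w → Distinct (p ++ y ∷ q) → Arranged (p ++ y ∷ q) (y ∷ w) ⇔ Arranged (p ++ q) w
arranged-∷ p y q w u = mk⇔
  (λ where (y∉w ∷ dw , _ ∷ w∈) → dw , All.zipWith (λ (y≢x , x∈) → ∈-delete p y≢x x∈) (y∉w , w∈))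
  (λ (dw , w∈) →
    All.map (λ { x∈ refl → proj₂ (unique-split p u) x∈ }) w∈ ∷ dw ,
    ∈-++⁺ʳ p (here refl) ∷ All.map (∈-insert p) w∈)

letters : ℕ → List ℕ
letters N = applyUpTo suc N

-- Passes from filtering all words to removing letters one at a time. The alphabet stays fixed while
-- `S` shrinks: a first letter outside `S` contributes nothing, and a first letter `y` of `S` leaves
-- an arrangement of `S` without `y`.
words-arr : ∀ N l f S → Distinct (letters N) → Distinct S → All (_∈ letters N) S →
            ∑ (λ w → ⟦ arranged? S w ⟧ * f w) (words N l) ≡ arr l f S
words-arr N zero f S uL uS S⊆ = trans (+-identityʳ _) (+-identityʳ (f []))
words-arr N (suc l) f S uL uS S⊆ = begin
  ∑ F (words N (suc l))                             ≡⟨ ∑-concatMap F _ (letters N) ⟩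
  ∑ (λ a → ∑ F (map (a ∷_) (words N l))) (letters N)
    ≡⟨ ∑-cong {xs = letters N} (All.universal (λ a → ∑-map F (a ∷_) (words N l)) _) ⟩
  ∑ k (letters N)                                   ≡⟨ ∑-support k S uL uS S⊆ off ⟩
  ∑ k S                                             ≡⟨ Σpick-∑ k S ⟨
  Σpick (λ _ y _ → k y) S                           ≡⟨ Σpick-cong S on ⟩
  arr (suc l) f S                                   ∎
  where
  F : List ℕ → ℕ
  F w = ⟦ arranged? S w ⟧ * f w
  k : ℕ → ℕ
  k a = ∑ (F ∘ (a ∷_)) (words N l)
  off : ∀ a → a ∉ S → k a ≡ 0
  off a a∉S = ∑-0 {xs = words N l} (All.universal
    (λ w → cong (_* f (a ∷ w)) (⟦⟧-no (arranged? S (a ∷ w)) λ (_ , a∈ ) → a∉S (All.head a∈))) _)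
  on : ∀ p y q → S ≡ p ++ y ∷ q → k y ≡ arr l (f ∘ (y ∷_)) (p ++ q)
  on p y q refl = trans
    (∑-cong {xs = words N l} (All.universal
      (λ w → cong (_* f (y ∷ w)) (⟦⟧-cong (arranged-∷ p y q w uS) (arranged? S (y ∷ w)) (arranged? (p ++ q) w))) _))
    (words-arr N l (f ∘ (y ∷_)) (p ++ q) uL (proj₁ (unique-split p uS))
      (let p⊆ , yq⊆ = All.++⁻ p S⊆ in All.++⁺ p⊆ (All.tail yq⊆)))

words-letters : ∀ N l → All (All (_∈ letters N)) (words N l)
words-letters N zero    = [] ∷ []
words-letters N (suc l) = All.concat⁺ (All.map⁺ (All.tabulate λ a∈ →
  All.map⁺ (All.map (a∈ ∷_) (words-letters N l))))

words-length : ∀ N l → All (λ w → length w ≡ l) (words N l)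
words-length N zero    = refl ∷ []
words-length N (suc l) = All.concat⁺ (All.map⁺ (All.universal (λ a →
  All.map⁺ (All.map (cong suc) (words-length N l))) (letters N)))

letters-sorted : ∀ N → AllPairs _<_ (letters N)
letters-sorted N = AllPairs.applyUpTo⁺₁ suc N λ i<j _ → s≤s i<j

∑-perms : ∀ N f → ∑ f (perms N) ≡ arr N f (letters N)
∑-perms N f = begin
  ∑ f (perms N)                                           ≡⟨ ∑-filter distinct? f (words N N) ⟩
  ∑ (λ w → ⟦ distinct? w ⟧ * f w) (words N N)             ≡⟨ ∑-cong (All.map (λ {w} w∈ → cong (_* f w)
      (⟦⟧-cong (mk⇔ (_, w∈) proj₁) (distinct? w) (arranged? (letters N) w))) (words-letters N N)) ⟩
  ∑ (λ w → ⟦ arranged? (letters N) w ⟧ * f w) (words N N)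
    ≡⟨ words-arr N N f (letters N) unique unique (All.tabulate λ a∈ → a∈) ⟩
  arr N f (letters N)                                     ∎
  where
  unique : Distinct (letters N)
  unique = AllPairs.map (λ x<y x≡y → <-irrefl x≡y x<y) (letters-sorted N)

perms-length : ∀ N → All (λ w → length w ≡ N) (perms N)
perms-length N = All.filter⁺ distinct? (words-length N N)

Σpick-count : ∀ {g} h xs → (∀ p y q → xs ≡ p ++ y ∷ q → g p y q ≡ h (length p) (length q)) →
              Σpick g xs ≡ Σsplit h (length xs)
Σpick-count h xs e = trans (Σpick-cong xs e) (Σpick-length h xs)

length-split : ∀ (p : List ℕ) {y q} → length (p ++ y ∷ q) ≡ suc (length p + length q)
length-split p {y} {q} = trans (length-++ p) (+-suc (length p) (length q))

sorted-split : ∀ p {y q} → AllPairs _<_ (p ++ y ∷ q) →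
               AllPairs _<_ (p ++ q) × All (_< y) p × All (y <_) q
sorted-split []      (y<q ∷ s) = s , [] , y<q
sorted-split (x ∷ p) (x< ∷ s) =
  let s′ , p<y , y<q = sorted-split p s
      x<p , x<yq = All.++⁻ p x<
  in (All.++⁺ x<p (All.tail x<yq) ∷ s′) , (All.head x<yq ∷ p<y) , y<q

-- Eulerian numbers

-- The number of ways to cut x ∷ w into r + 1 blocks, cutting at every descent and
-- at any choice of ascents.
cuts : ℕ → ℕ → List ℕ → ℕ
cuts zero    x []      = 1
cuts (suc r) x []      = 0
cuts zero    x (y ∷ w) = if does (y <? x) then 0 else cuts zero y w
cuts (suc r) x (y ∷ w) = if does (y <? x) then cuts r y w else cuts (suc r) y w + cuts r y w

arr-cuts : ∀ l r x lo hi → AllPairs _<_ (lo ++ hi) → All (_< x) lo → All (x <_) hi →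
           length lo + length hi ≡ l → arr l (cuts r x) (lo ++ hi) ≡ T (length lo) (length hi) r
arr-cuts zero zero    x [] [] _ _ _ _ = refl
arr-cuts zero (suc r) x [] [] _ _ _ _ = refl
arr-cuts (suc l) r x lo hi sorted lo<x x<hi len =
  trans (Σpick-++ _ lo hi) (step r)
  where
  a = length lo
  b = length hi

  below : ∀ r p y q → lo ≡ p ++ y ∷ q →
          y < x × arr l (cuts r y) (p ++ (q ++ hi)) ≡ T (length p) (length q + b) r
  below r p y q refl =
    let y<x = All.head (All.++⁻ʳ p lo<x)
        s , p<y , y<q++hi = sorted-split p (subst (AllPairs _<_) (++-assoc p (y ∷ q) hi) sorted)
    in y<x , trans
      (arr-cuts l r y p (q ++ hi) s p<y y<q++hi (suc-injective (begin
        suc (length p + length (q ++ hi))     ≡⟨ cong (λ c → suc (length p + c)) (length-++ q) ⟩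
        suc (length p + (length q + b))       ≡⟨ cong suc (+-assoc (length p) _ _) ⟨
        suc (length p + length q) + b         ≡⟨ cong (_+ b) (length-split p) ⟨
        length (p ++ y ∷ q) + b               ≡⟨ len ⟩
        suc l                                 ∎)))
      (cong (λ c → T (length p) c r) (length-++ q))

  above : ∀ r p y q → hi ≡ p ++ y ∷ q →
          ¬ (y < x) × arr l (cuts r y) ((lo ++ p) ++ q) ≡ T (a + length p) (length q) r
  above r p y q refl =
    let x<y = All.head (All.++⁻ʳ p x<hi)
        s , lo++p<y , y<q = sorted-split (lo ++ p) (subst (AllPairs _<_) (sym (++-assoc lo p (y ∷ q))) sorted)
    in <⇒≯ x<y , trans
      (arr-cuts l r y (lo ++ p) q s lo++p<y y<q (suc-injective (begin
        suc (length (lo ++ p) + length q)     ≡⟨ cong (λ c → suc (c + length q)) (length-++ lo) ⟩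
        suc (a + length p + length q)         ≡⟨ cong suc (+-assoc a _ _) ⟩
        suc (a + (length p + length q))       ≡⟨ +-suc a _ ⟨
        a + suc (length p + length q)         ≡⟨ cong (a +_) (length-split p) ⟨
        a + length (p ++ y ∷ q)               ≡⟨ len ⟩
        suc l                                 ∎)))
      (cong (λ c → T c (length q) r) (length-++ lo))

  step : ∀ r → Σpick (λ p y q → arr l (cuts r x ∘ (y ∷_)) (p ++ (q ++ hi))) lo
             + Σpick (λ p y q → arr l (cuts r x ∘ (y ∷_)) ((lo ++ p) ++ q)) hi ≡ T a b r
  step zero = begin
    _ ≡⟨ cong₂ _+_ (Σpick-cong lo lower) (Σpick-count (λ t u → T (a + t) u 0) hi upper) ⟩
    Σpick (λ _ _ _ → 0) lo + Σsplit (λ t u → T (a + t) u 0) b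
      ≡⟨ cong (_+ Σsplit (λ t u → T (a + t) u 0) b) (Σpick-0 lo) ⟩
    Σsplit (λ t u → T (a + t) u 0) b
      ≡⟨ T-rec-zero a b (≤-trans z<s (≤-reflexive (sym len))) ⟩
    T a b 0                                                   ∎
    where
    lower : ∀ p y q → lo ≡ p ++ y ∷ q → arr l (cuts 0 x ∘ (y ∷_)) (p ++ (q ++ hi)) ≡ 0
    lower p y q e rewrite dec-true (y <? x) (proj₁ (below 0 p y q e)) = arr-0 l _
    upper : ∀ p y q → hi ≡ p ++ y ∷ q →
            arr l (cuts 0 x ∘ (y ∷_)) ((lo ++ p) ++ q) ≡ T (a + length p) (length q) 0
    upper p y q e rewrite dec-false (y <? x) (proj₁ (above 0 p y q e)) = proj₂ (above 0 p y q e)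
  step (suc r) = begin
    _ ≡⟨ cong₂ _+_ (Σpick-count (λ t u → T t (u + b) r) lo lower)
                   (Σpick-count (λ t u → T (a + t) u (suc r) + T (a + t) u r) hi upper) ⟩
    Σsplit (λ t u → T t (u + b) r) a + Σsplit (λ t u → T (a + t) u (suc r) + T (a + t) u r) b
      ≡⟨ T-rec-suc a b r ⟩
    T a b (suc r) ∎
    where
    lower : ∀ p y q → lo ≡ p ++ y ∷ q →
            arr l (cuts (suc r) x ∘ (y ∷_)) (p ++ (q ++ hi)) ≡ T (length p) (length q + b) r
    lower p y q e rewrite dec-true (y <? x) (proj₁ (below r p y q e)) = proj₂ (below r p y q e)
    upper : ∀ p y q → hi ≡ p ++ y ∷ q → arr l (cuts (suc r) x ∘ (y ∷_)) ((lo ++ p) ++ q)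
            ≡ T (a + length p) (length q) (suc r) + T (a + length p) (length q) r
    upper p y q e rewrite dec-false (y <? x) (proj₁ (above r p y q e)) =
      trans (arr-+ l (cuts (suc r) y) (cuts r y) ((lo ++ p) ++ q))
            (cong₂ _+_ (proj₂ (above (suc r) p y q e)) (proj₂ (above r p y q e)))

-- bin a r d = C(a, r - d) without truncating the subtraction.
bin : ℕ → ℕ → ℕ → ℕ
bin a r       zero    = a C r
bin a zero    (suc d) = 0
bin a (suc r) (suc d) = bin a r d

bin-0 : ∀ a d → bin (suc a) 0 d ≡ bin a 0 d
bin-0 a zero    = refl
bin-0 a (suc d) = refl

bin-pascal : ∀ a r d → bin (suc a) (suc r) d ≡ bin a (suc r) d + bin a r d
bin-pascal a r       zero          = trans (sym (nCk+nC[k+1]≡[n+1]C[k+1] a r)) (+-comm (a C r) _)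
bin-pascal a zero    (suc zero)    = refl
bin-pascal a zero    (suc (suc d)) = refl
bin-pascal a (suc r) (suc d)       = bin-pascal a r d

binomℤ-bin : ∀ a r d → binomℤ a (r ⊖ d) ≡ bin a r d
binomℤ-bin a r       zero    = refl
binomℤ-bin a zero    (suc d) = refl
binomℤ-bin a (suc r) (suc d) = trans (cong (binomℤ a) (ℤ.[1+m]⊖[1+n]≡m⊖n r d)) (binomℤ-bin a r d)

descents-< : ∀ {x y} ys → y < x → descents (x ∷ y ∷ ys) ≡ suc (descents (y ∷ ys))
descents-< {x} {y} ys y<x with y <? x
... | yes _   = refl
... | no y≮x = contradiction y<x y≮x

descents-≮ : ∀ {x y} ys → ¬ y < x → descents (x ∷ y ∷ ys) ≡ descents (y ∷ ys)
descents-≮ {x} {y} ys y≮x with y <? x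
... | yes y<x = contradiction y<x y≮x
... | no _    = refl

descents-≤ : ∀ x ys → descents (x ∷ ys) ≤ length ys
descents-≤ x []       = z≤n
descents-≤ x (y ∷ ys) with y <? x
... | yes _ = s≤s (descents-≤ y ys)
... | no  _ = m≤n⇒m≤1+n (descents-≤ y ys)

-- With `d` descents, `d` of the `r` cuts are forced, and the other `r - d` are chosen freely among
-- the `length w - d` adjacent pairs that do not descend.
cuts-bin : ∀ r x w → cuts r x w ≡ bin (length w ∸ descents (x ∷ w)) r (descents (x ∷ w))
cuts-bin zero    x []      = refl
cuts-bin (suc r) x []      = sym (k>n⇒nCk≡0 (z<s {r}))
cuts-bin r x (y ∷ w) = byCases r (y <? x)
  where
  d = descents (y ∷ w)
  byCases : ∀ r → Dec (y < x) →
            cuts r x (y ∷ w) ≡ bin (suc (length w) ∸ descents (x ∷ y ∷ w)) r (descents (x ∷ y ∷ w))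
  byCases zero (yes y<x) rewrite descents-< w y<x | dec-true (y <? x) y<x = refl
  byCases (suc r) (yes y<x) rewrite descents-< w y<x | dec-true (y <? x) y<x = cuts-bin r y w
  byCases zero (no y≮x) rewrite descents-≮ w y≮x | dec-false (y <? x) y≮x | +-∸-assoc 1 (descents-≤ y w) =
    trans (cuts-bin 0 y w) (sym (bin-0 _ d))
  byCases (suc r) (no y≮x) rewrite descents-≮ w y≮x | dec-false (y <? x) y≮x | +-∸-assoc 1 (descents-≤ y w) =
    trans (cong₂ _+_ (cuts-bin (suc r) y w) (cuts-bin r y w)) (sym (bin-pascal _ r d))

Σ≤-⟦⟧ : ∀ n d (g : ℕ → ℕ) → d ≤ n → Σ≤ n (λ i → ⟦ d ≟ i ⟧ * g i) ≡ g d
Σ≤-⟦⟧ zero    zero g z≤n = +-identityʳ (g 0)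
Σ≤-⟦⟧ (suc n) d    g d≤1+n with m≤n⇒m<n∨m≡n d≤1+n
... | inj₁ d<1+n rewrite dec-false (d ≟ suc n) (<⇒≢ d<1+n) =
  trans (+-identityʳ _) (Σ≤-⟦⟧ n d g (s≤s⁻¹ d<1+n))
... | inj₂ refl rewrite dec-true (suc n ≟ suc n) refl = begin
  Σ≤ n (λ i → ⟦ suc n ≟ i ⟧ * g i) + (g (suc n) + 0)
    ≡⟨ cong₂ _+_ (trans (Σ≤-cong n λ i i≤n → cong (_* g i) (⟦⟧-no (suc n ≟ i) (>⇒≢ (s≤s i≤n)))) (Σ≤-0 n)) (+-identityʳ _) ⟩
  g (suc n) ∎
  where
  Σ≤-0 : ∀ n → Σ≤ n (λ _ → 0) ≡ 0
  Σ≤-0 n = Σ≤-*ˡ n 0 (λ _ → 0)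

-- Grouping by the value of `d`; the bound by `n` ensures that no fibre is missed.
Σ≤-fibres : ∀ n (d : A → ℕ) (g : ℕ → ℕ) xs → All (λ x → d x ≤ n) xs →
            Σ≤ n (λ i → ∑ (λ x → ⟦ d x ≟ i ⟧) xs * g i) ≡ ∑ (g ∘ d) xs
Σ≤-fibres n d g []       []        = Σ≤-*ˡ n 0 (λ _ → 0)
Σ≤-fibres n d g (x ∷ xs) (d≤n ∷ e) = begin
  Σ≤ n (λ i → (⟦ d x ≟ i ⟧ + ∑ (λ x → ⟦ d x ≟ i ⟧) xs) * g i)
    ≡⟨ Σ≤-cong n (λ i _ → *-distribʳ-+ (g i) ⟦ d x ≟ i ⟧ _) ⟩
  Σ≤ n (λ i → ⟦ d x ≟ i ⟧ * g i + ∑ (λ x → ⟦ d x ≟ i ⟧) xs * g i)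
    ≡⟨ Σ≤-+ n _ _ ⟩
  Σ≤ n (λ i → ⟦ d x ≟ i ⟧ * g i) + Σ≤ n (λ i → ∑ (λ x → ⟦ d x ≟ i ⟧) xs * g i)
    ≡⟨ cong₂ _+_ (Σ≤-⟦⟧ n (d x) g d≤n) (Σ≤-fibres n d g xs e) ⟩
  g (d x) + ∑ (g ∘ d) xs ∎

∑-applyUpTo : ∀ f (g : ℕ → A) n → ∑ f (applyUpTo g (suc n)) ≡ Σ≤ n (f ∘ g)
∑-applyUpTo f g zero    = +-identityʳ _
∑-applyUpTo f g (suc n) = trans (cong (f (g 0) +_) (∑-applyUpTo f (g ∘ suc) n)) (sym (Σ≤-head n (f ∘ g)))

Σ[0‥]-Σ≤ : ∀ n f → Σ[0‥ n ] f ≡ Σ≤ n f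
Σ[0‥]-Σ≤ n f = ∑-applyUpTo f id n

letters-positive : ∀ N → All (0 <_) (letters N)
letters-positive N = All.applyUpTo⁺₁ suc N λ _ → z<s

-- For a permutation with `d = i - 1` descents the binomial is `C(n - d, m - d)`, the number of ways
-- to cut `0 ∷ π` into `m + 1` blocks: the letter 0 adds an ascent but no descent, so `n - d`
-- ascents are available.
eulerian-T : ∀ n m → 0 < n →
  Σ≤ n (λ i → eulerian n i * binomℤ (n + 1 ∸ i) ((ℤ.+ (m + 1)) ℤ.- (ℤ.+ i))) ≡ T 0 n m
eulerian-T n m 0<n = begin
  Σ≤ n (λ i → eulerian n i * g i)
    ≡⟨ Σ≤-cong n (λ i _ → cong (_* g i) (length-filter (λ π → suc (descents π) ≟ i) (perms n))) ⟩
  Σ≤ n (λ i → ∑ (λ π → ⟦ suc (descents π) ≟ i ⟧) (perms n) * g i)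
    ≡⟨ Σ≤-fibres n (suc ∘ descents) g (perms n) (All.map (λ {π} → bound π) (perms-length n)) ⟩
  ∑ (g ∘ suc ∘ descents) (perms n)
    ≡⟨ ∑-cong (All.map (λ {π} → weight π) (perms-length n)) ⟩
  ∑ (cuts m 0) (perms n)
    ≡⟨ ∑-perms n (cuts m 0) ⟩
  arr n (cuts m 0) (letters n)
    ≡⟨ arr-cuts n m 0 [] (letters n) (letters-sorted n) [] (letters-positive n) (length-applyUpTo suc n) ⟩
  T 0 (length (letters n)) m
    ≡⟨ cong (λ b → T 0 b m) (length-applyUpTo suc n) ⟩
  T 0 n m ∎
  where
  g : ℕ → ℕ
  g i = binomℤ (n + 1 ∸ i) ((ℤ.+ (m + 1)) ℤ.- (ℤ.+ i))

  bound : ∀ π → length π ≡ n → suc (descents π) ≤ n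
  bound []      refl = 0<n
  bound (x ∷ π) refl = s≤s (descents-≤ x π)

  weight : ∀ π → length π ≡ n → g (suc (descents π)) ≡ cuts m 0 π
  weight []      refl = contradiction 0<n (<-irrefl refl)
  weight (x ∷ π) refl = sym (begin
    cuts m 0 (x ∷ π)
      ≡⟨ cuts-bin m 0 (x ∷ π) ⟩
    bin (n ∸ descents (0 ∷ x ∷ π)) m (descents (0 ∷ x ∷ π))
      ≡⟨ cong (λ d → bin (n ∸ d) m d) (descents-≮ {0} π λ ()) ⟩
    bin (n ∸ d) m d
      ≡⟨ binomℤ-bin (n ∸ d) m d ⟨
    binomℤ (n ∸ d) (m ⊖ d)
      ≡⟨ cong (binomℤ (n ∸ d)) (ℤ.[1+m]⊖[1+n]≡m⊖n m d) ⟨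
    binomℤ (suc n ∸ suc d) (suc m ⊖ suc d)
      ≡⟨ cong₂ (λ n m → binomℤ (n ∸ suc d) (m ⊖ suc d)) (+-comm n 1) (+-comm m 1) ⟨
    g (suc d) ∎)
    where d = descents (x ∷ π)

eulerianSum-T : ∀ n k → 0 < n → 0 < k → eulerianSum n k ≡ Σ≤ (n ⊓ k) (λ m → T 0 n m * T 0 k m)
eulerianSum-T n k 0<n 0<k = trans (Σ[0‥]-Σ≤ (n ⊓ k) _) (Σ≤-cong (n ⊓ k) λ m _ → inner m)
  where
  ring : ∀ x y b c → x * y * b * c ≡ x * b * (y * c)
  ring = solve-∀
  inner : ∀ m → Σ[0‥ n ] (λ i → Σ[0‥ k ] λ j → eulerian n i * eulerian k j
      * binomℤ (n + 1 ∸ i) ((ℤ.+ (m + 1)) ℤ.- (ℤ.+ i)) * binomℤ (k + 1 ∸ j) ((ℤ.+ (m + 1)) ℤ.- (ℤ.+ j)))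
      ≡ T 0 n m * T 0 k m
  inner m = begin
    _ ≡⟨ Σ[0‥]-Σ≤ n _ ⟩
    _
      ≡⟨ Σ≤-cong n (λ i _ → trans (Σ[0‥]-Σ≤ k _) (trans (Σ≤-cong k (λ j _ → ring (eulerian n i) (eulerian k j) _ _)) (Σ≤-*ˡ k (f i) g))) ⟩
    Σ≤ n (λ i → f i * Σ≤ k g) ≡⟨ Σ≤-*ʳ n (Σ≤ k g) f ⟩
    Σ≤ n f * Σ≤ k g           ≡⟨ cong₂ _*_ (eulerian-T n m 0<n) (eulerian-T k m 0<k) ⟩
    T 0 n m * T 0 k m         ∎
    where
    f g : ℕ → ℕ
    f i = eulerian n i * binomℤ (n + 1 ∸ i) ((ℤ.+ (m + 1)) ℤ.- (ℤ.+ i))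
    g j = eulerian k j * binomℤ (k + 1 ∸ j) ((ℤ.+ (m + 1)) ℤ.- (ℤ.+ j))

-- Callan permutations

SameSide : ℕ → ℕ → ℕ → Set
SameSide n x y = (InN n x × InN n y) ⊎ (InK n x × InK n y)

-- Local form of the Callan condition: a substring of one colour increases as soon as its adjacent
-- pairs do, so a word can be tested letter by letter.
Step : ℕ → ℕ → ℕ → Set
Step n x y = SameSide n x y → x < y

step? : ∀ n x y → Dec (Step n x y)
step? n x y = ((x ≤? n ×-dec y ≤? n) ⊎-dec (n <? x ×-dec n <? y)) →-dec x <? y

callan⇒linked : ∀ n π → CallanCondition n π → Linked (Step n) π
callan⇒linked n []          _                   = []
callan⇒linked n (x ∷ [])    _                   = [-]
-- The initial segments begin with `[]`, `[x]`, `[x, y]`; `pair` is the condition for the third.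
callan⇒linked n (x ∷ y ∷ π) c@(_ ∷ _ ∷ pair ∷ _) =
  step ∷ callan⇒linked n (y ∷ π) (All.++⁻ʳ (inits (x ∷ y ∷ π)) c)
  where
  increasing₂ : Increasing (x ∷ y ∷ []) → x < y
  increasing₂ (x<y ∷ _) = x<y
  step : Step n x y
  step (inj₁ (xN , yN)) = increasing₂ (pair (inj₁ (xN ∷ yN ∷ [])))
  step (inj₂ (xK , yK)) = increasing₂ (pair (inj₂ (xK ∷ yK ∷ [])))

linked-inits : ∀ {R : ℕ → ℕ → Set} {x w} → Linked R (x ∷ w) → All (λ s → Linked R (x ∷ s)) (inits w)
linked-inits [-]       = [-] ∷ []
linked-inits (xRy ∷ l) = [-] ∷ All.map⁺ (All.map (xRy ∷_) (linked-inits l))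

linked-tail : ∀ {R : ℕ → ℕ → Set} {x w} → Linked R (x ∷ w) → Linked R w
linked-tail [-]     = []
linked-tail (_ ∷ l) = l

linked⇒increasing : ∀ n {s} → Linked (Step n) s → All (InN n) s ⊎ All (InK n) s → Increasing s
linked⇒increasing n []         _                    = []
linked⇒increasing n [-]        _                    = [-]
linked⇒increasing n (step ∷ l) (inj₁ (x ∷ y ∷ inN)) =
  step (inj₁ (x , y)) ∷ linked⇒increasing n l (inj₁ (y ∷ inN))
linked⇒increasing n (step ∷ l) (inj₂ (x ∷ y ∷ inK)) =
  step (inj₂ (x , y)) ∷ linked⇒increasing n l (inj₂ (y ∷ inK))

linked⇒callan : ∀ n π → Linked (Step n) π → CallanCondition n π
linked⇒callan n []      _ = (λ _ → []) ∷ []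
linked⇒callan n (x ∷ π) l = All.++⁺
  ((λ _ → []) ∷ All.map⁺ (All.map (linked⇒increasing n) (linked-inits l)))
  (linked⇒callan n π (linked-tail l))

callanFrom : ℕ → ℕ → List ℕ → ℕ
callanFrom n x w = ⟦ linked? (step? n) (x ∷ w) ⟧

callanFrom-step : ∀ n x y w → Step n x y → callanFrom n x (y ∷ w) ≡ callanFrom n y w
callanFrom-step n x y w s =
  ⟦⟧-cong (mk⇔ linked-tail (s ∷_)) (linked? (step? n) (x ∷ y ∷ w)) (linked? (step? n) (y ∷ w))

callanFrom-stuck : ∀ n x y w → ¬ Step n x y → callanFrom n x (y ∷ w) ≡ 0
callanFrom-stuck n x y w ¬s =
  ⟦⟧-no (linked? (step? n) (x ∷ y ∷ w)) λ { (s ∷ _) → ¬s s }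

Remaining : ℕ → List ℕ → Set
Remaining l S = AllPairs _<_ S × length S ≡ l

remaining-pick : ∀ {l} p {y q} → Remaining (suc l) (p ++ y ∷ q) →
                 Remaining l (p ++ q) × All (_< y) p × All (y <_) q
remaining-pick p (s , len) =
  let s′ , p<y , y<q = sorted-split p s
  in (s′ , suc-injective (trans (trans (cong suc (length-++ p)) (sym (length-split p))) len)) , p<y , y<q

length-++₃ : ∀ (xs ys zs : List ℕ) → length (xs ++ (ys ++ zs)) ≡ length xs + (length ys + length zs)
length-++₃ xs ys zs = trans (length-++ xs) (cong (length xs +_) (length-++ ys))

X-zero : ∀ R → X R 0 0 0 ≡ 1
X-zero R = sym (Σ≤-extend 0 R z≤n λ { (suc i) _ → refl })

arr-callanN : ∀ R n l → l ≤ R → ∀ x lo hi ks → Remaining l (lo ++ (hi ++ ks)) →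
  x ≤ n → All (_< x) lo → All (x <_) hi → All (InN n) hi → All (InK n) ks →
  arr l (callanFrom n x) (lo ++ (hi ++ ks)) ≡ X R (length lo) (length hi) (length ks)
arr-callanK : ∀ R n l → l ≤ R → ∀ x ns lo hi → Remaining l (ns ++ (lo ++ hi)) →
  n < x → All (_< x) lo → All (x <_) hi → All (InK n) lo → All (InN n) ns →
  arr l (callanFrom n x) (ns ++ (lo ++ hi)) ≡ X R (length lo) (length hi) (length ns)

arr-callanN R n zero    l≤R x [] [] [] _ _ _ _ _ _ = sym (X-zero R)
arr-callanN R n (suc l) l≤R x lo hi ks rem x≤n lo<x x<hi hiN ksK = begin
  arr (suc l) (callanFrom n x) (lo ++ (hi ++ ks))
    ≡⟨ trans (Σpick-++ _ lo (hi ++ ks)) (cong (Σpick _ lo +_) (Σpick-++ _ hi ks)) ⟩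
  _ ≡⟨ cong₂ _+_ (trans (Σpick-cong lo below) (Σpick-0 lo))
         (cong₂ _+_ (Σpick-count (λ t u → X R (a + t) u c) hi above)
                    (Σpick-count (λ t u → X R t u (a + b)) ks across)) ⟩
  Σsplit (λ t u → X R (a + t) u c) b + Σsplit (λ t u → X R t u (a + b)) c
    ≡⟨ X-rec R a b c (≤-trans z<s (≤-reflexive (sym total))) (≤-trans (≤-reflexive total) l≤R) ⟩
  X R a b c ∎
  where
  a = length lo
  b = length hi
  c = length ks
  total : a + b + c ≡ suc l
  total = trans (+-assoc a b c) (trans (sym (length-++₃ lo hi ks)) (proj₂ rem))

  below : ∀ p y q → lo ≡ p ++ y ∷ q →
          arr l (callanFrom n x ∘ (y ∷_)) (p ++ (q ++ (hi ++ ks))) ≡ 0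
  below p y q refl = trans
    (arr-cong l _ λ w → callanFrom-stuck n x y w λ s →
      <-asym y<x (s (inj₁ (x≤n , ≤-trans (<⇒≤ y<x) x≤n))))
    (arr-0 l _)
    where y<x = All.head (All.++⁻ʳ p lo<x)

  above : ∀ p y q → hi ≡ p ++ y ∷ q →
          arr l (callanFrom n x ∘ (y ∷_)) ((lo ++ p) ++ (q ++ ks)) ≡ X R (a + length p) (length q) c
  above p y q refl =
    let x<y = All.head (All.++⁻ʳ p x<hi)
        y∷q≤n = All.++⁻ʳ p hiN
        rem′ , lo++p<y , y<q++ks = remaining-pick (lo ++ p) (subst (Remaining (suc l))
          (trans (cong (lo ++_) (++-assoc p (y ∷ q) ks)) (sym (++-assoc lo p _))) rem)
    in trans (arr-cong l _ λ w → callanFrom-step n x y w λ _ → x<y)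
      (trans (arr-callanN R n l (<⇒≤ l≤R) y (lo ++ p) q ks rem′ (All.head y∷q≤n) lo++p<y
                (All.++⁻ˡ q y<q++ks) (All.tail y∷q≤n) ksK)
             (cong (λ t → X R t (length q) c) (length-++ lo)))

  across : ∀ p y q → ks ≡ p ++ y ∷ q →
           arr l (callanFrom n x ∘ (y ∷_)) ((lo ++ (hi ++ p)) ++ q) ≡ X R (length p) (length q) (a + b)
  across p y q refl =
    let p>n , y∷q>n = All.++⁻ p ksK
        n<y = All.head y∷q>n
        rem′ , lohip<y , y<q = remaining-pick (lo ++ (hi ++ p)) (subst (Remaining (suc l))
          (trans (cong (lo ++_) (sym (++-assoc hi p (y ∷ q)))) (sym (++-assoc lo (hi ++ p) _))) rem)
        regroup = trans (cong (_++ q) (sym (++-assoc lo hi p))) (++-assoc (lo ++ hi) p q)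
        crossing : Step n x y
        crossing _ = ≤-<-trans x≤n n<y
    in trans (arr-cong l _ λ w → callanFrom-step n x y w crossing)
      (trans (cong (arr l (callanFrom n y)) regroup)
      (trans (arr-callanK R n l (<⇒≤ l≤R) y (lo ++ hi) p q (subst (Remaining l) regroup rem′) n<y
                (All.++⁻ʳ hi (All.++⁻ʳ lo lohip<y)) y<q p>n
                (All.++⁺ (All.map (λ z<x → ≤-trans (<⇒≤ z<x) x≤n) lo<x) hiN))
             (cong (X R (length p) (length q)) (length-++ lo))))

arr-callanK R n zero    l≤R x [] [] [] _ _ _ _ _ _ = sym (X-zero R)
arr-callanK R n (suc l) l≤R x ns lo hi rem n<x lo<x x<hi loK nsN = begin
  arr (suc l) (callanFrom n x) (ns ++ (lo ++ hi))
    ≡⟨ trans (Σpick-++ _ ns (lo ++ hi)) (cong (Σpick _ ns +_) (Σpick-++ _ lo hi)) ⟩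
  _ ≡⟨ cong₂ _+_ (Σpick-count (λ t u → X R t u (a + b)) ns across)
         (cong₂ _+_ (trans (Σpick-cong lo below) (Σpick-0 lo))
                    (Σpick-count (λ t u → X R (a + t) u c) hi above)) ⟩
  Σsplit (λ t u → X R t u (a + b)) c + Σsplit (λ t u → X R (a + t) u c) b
    ≡⟨ +-comm (Σsplit (λ t u → X R t u (a + b)) c) _ ⟩
  Σsplit (λ t u → X R (a + t) u c) b + Σsplit (λ t u → X R t u (a + b)) c
    ≡⟨ X-rec R a b c (≤-trans z<s (≤-reflexive (sym total))) (≤-trans (≤-reflexive total) l≤R) ⟩
  X R a b c ∎
  where
  a = length lo
  b = length hi
  c = length ns
  total : a + b + c ≡ suc l
  total = trans (+-comm (a + b) c) (trans (sym (length-++₃ ns lo hi)) (proj₂ rem))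

  across : ∀ p y q → ns ≡ p ++ y ∷ q →
           arr l (callanFrom n x ∘ (y ∷_)) (p ++ (q ++ (lo ++ hi))) ≡ X R (length p) (length q) (a + b)
  across p y q refl =
    let y∷q≤n = All.++⁻ʳ p nsN
        y≤n = All.head y∷q≤n
        rem′ , p<y , y<rest = remaining-pick p (subst (Remaining (suc l)) (++-assoc p (y ∷ q) (lo ++ hi)) rem)
        crossing : Step n x y
        crossing = λ where
          (inj₁ (x≤n , _)) → contradiction n<x (≤⇒≯ x≤n)
          (inj₂ (_ , n<y)) → contradiction n<y (≤⇒≯ y≤n)
    in trans (arr-cong l _ λ w → callanFrom-step n x y w crossing)
      (trans (arr-callanN R n l (<⇒≤ l≤R) y p q (lo ++ hi) rem′ y≤n p<y
                (All.++⁻ˡ q y<rest) (All.tail y∷q≤n)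
                (All.++⁺ loK (All.map (<-trans n<x) x<hi)))
             (cong (X R (length p) (length q)) (length-++ lo)))

  below : ∀ p y q → lo ≡ p ++ y ∷ q →
          arr l (callanFrom n x ∘ (y ∷_)) ((ns ++ p) ++ (q ++ hi)) ≡ 0
  below p y q refl = trans
    (arr-cong l _ λ w → callanFrom-stuck n x y w λ s →
      <-asym y<x (s (inj₂ (n<x , All.head (All.++⁻ʳ p loK)))))
    (arr-0 l _)
    where y<x = All.head (All.++⁻ʳ p lo<x)

  above : ∀ p y q → hi ≡ p ++ y ∷ q →
          arr l (callanFrom n x ∘ (y ∷_)) ((ns ++ (lo ++ p)) ++ q) ≡ X R (a + length p) (length q) c
  above p y q refl =
    let p>x , y∷q>x = All.++⁻ p x<hi
        x<y = All.head y∷q>x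
        rem′ , nslop<y , y<q = remaining-pick (ns ++ (lo ++ p)) (subst (Remaining (suc l))
          (trans (cong (ns ++_) (sym (++-assoc lo p (y ∷ q)))) (sym (++-assoc ns (lo ++ p) _))) rem)
        regroup = ++-assoc ns (lo ++ p) q
    in trans (arr-cong l _ λ w → callanFrom-step n x y w λ _ → x<y)
      (trans (cong (arr l (callanFrom n y)) regroup)
      (trans (arr-callanK R n l (<⇒≤ l≤R) y ns (lo ++ p) q (subst (Remaining l) regroup rem′) (<-trans n<x x<y)
                (All.++⁻ʳ ns nslop<y) y<q (All.++⁺ loK (All.map (<-trans n<x) p>x)) nsN)
             (cong (λ t → X R t (length q) c) (length-++ lo))))

applyUpTo-+ : ∀ {A : Set} (f : ℕ → A) m n → applyUpTo f (m + n) ≡ applyUpTo f m ++ applyUpTo (λ i → f (m + i)) n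
applyUpTo-+ f zero    n = refl
applyUpTo-+ f (suc m) n = cong (f 0 ∷_) (applyUpTo-+ (f ∘ suc) m n)

T-product-vanish : ∀ n k m → n ⊓ k < m → T 0 n m * T 0 k m ≡ 0
T-product-vanish n k m n⊓k<m with ⊓-sel n k
... | inj₁ n⊓k≡n = cong (_* T 0 k m) (T-vanish 0 n m (subst (_< m) n⊓k≡n n⊓k<m))
... | inj₂ n⊓k≡k = trans (cong (T 0 n m *_) (T-vanish 0 k m (subst (_< m) n⊓k≡k n⊓k<m))) (*-zeroʳ (T 0 n m))

perms-letters : ∀ N → All (All (_∈ letters N)) (perms N)
perms-letters N = All.filter⁺ distinct? (words-letters N N)

-- The letter 0 counts as an element of `N` below all others, hence forbids no first letter; the
-- count starts with `n` letters above it and `k` of the other colour. Terms beyond `n ⊓ k` vanish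
-- by degree.
numCallan-T : ∀ n k → numCallan n k ≡ Σ≤ (n ⊓ k) (λ m → T 0 n m * T 0 k m)
numCallan-T n k = begin
  numCallan n k
    ≡⟨ length-filter (callan? n) (perms N) ⟩
  ∑ (λ π → ⟦ callan? n π ⟧) (perms N)
    ≡⟨ ∑-cong (All.map (λ {π} π∈ → ⟦⟧-cong (fromZero π (All.map (All.lookup (letters-positive N)) π∈))
         (callan? n π) (linked? (step? n) (0 ∷ π))) (perms-letters N)) ⟩
  ∑ (callanFrom n 0) (perms N)
    ≡⟨ ∑-perms N (callanFrom n 0) ⟩
  arr N (callanFrom n 0) (letters N)
    ≡⟨ cong (arr N (callanFrom n 0)) split ⟩
  arr N (callanFrom n 0) (letters n ++ ks)
    ≡⟨ arr-callanN N n N ≤-refl 0 [] (letters n) ks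
         (subst (Remaining N) split (letters-sorted N , length-applyUpTo suc N))
         z≤n [] (letters-positive n) (All.applyUpTo⁺₁ suc n id) (All.applyUpTo⁺₁ _ k λ _ → s≤s (m≤m+n n _)) ⟩
  X N 0 (length (letters n)) (length ks)
    ≡⟨ cong₂ (X N 0) (length-applyUpTo suc n) (length-applyUpTo _ k) ⟩
  Σ≤ N (λ m → T 0 n m * T 0 k m)
    ≡⟨ Σ≤-extend (n ⊓ k) N (≤-trans (m⊓n≤m n k) (m≤m+n n k)) (T-product-vanish n k) ⟨
  Σ≤ (n ⊓ k) (λ m → T 0 n m * T 0 k m) ∎
  where
  N = n + k
  ks = applyUpTo (λ i → suc (n + i)) k
  split : letters N ≡ letters n ++ ks
  split = applyUpTo-+ suc n k
  fromZero : ∀ π → All (0 <_) π → CallanCondition n π ⇔ Linked (Step n) (0 ∷ π)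
  fromZero []      _         = mk⇔ (λ _ → [-]) (λ _ → linked⇒callan n [] [])
  fromZero (x ∷ π) (0<x ∷ _) = mk⇔ (λ c → (λ _ → 0<x) ∷ callan⇒linked n (x ∷ π) c)
                                    (λ l → linked⇒callan n (x ∷ π) (linked-tail l))

-- Poly-Bernoulli numbers

ΣQ-Σ≤ : ∀ n f → ΣQ[0‥ n ] f ≡ Q.Σ≤ n f
ΣQ-Σ≤ zero    f = refl
ΣQ-Σ≤ (suc n) f = cong (ℚ._+ f (suc n)) (ΣQ-Σ≤ n f)

-- Lets identities for `ι` be checked on unnormalised fractions, where they are identities of
-- integers.
fromℚᵘ-homo-+ : ∀ p q → ℚ.fromℚᵘ (p ℚᵘ.+ q) ≡ ℚ.fromℚᵘ p ℚ.+ ℚ.fromℚᵘ q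
fromℚᵘ-homo-+ p q = ℚ.toℚᵘ-injective (ℚᵘ.≃-trans (ℚ.toℚᵘ-fromℚᵘ (p ℚᵘ.+ q)) (ℚᵘ.≃-sym
  (ℚᵘ.≃-trans (ℚ.toℚᵘ-homo-+ (ℚ.fromℚᵘ p) (ℚ.fromℚᵘ q))
              (ℚᵘ.+-cong (ℚ.toℚᵘ-fromℚᵘ p) (ℚ.toℚᵘ-fromℚᵘ q)))))

fromℚᵘ-homo-* : ∀ p q → ℚ.fromℚᵘ (p ℚᵘ.* q) ≡ ℚ.fromℚᵘ p ℚ.* ℚ.fromℚᵘ q
fromℚᵘ-homo-* p q = ℚ.toℚᵘ-injective (ℚᵘ.≃-trans (ℚ.toℚᵘ-fromℚᵘ (p ℚᵘ.* q)) (ℚᵘ.≃-sym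
  (ℚᵘ.≃-trans (ℚ.toℚᵘ-homo-* (ℚ.fromℚᵘ p) (ℚ.fromℚᵘ q))
              (ℚᵘ.*-cong (ℚ.toℚᵘ-fromℚᵘ p) (ℚ.toℚᵘ-fromℚᵘ q)))))

ι : ℕ → ℚ
ι n = (ℤ.+ n) / 1

ι-+ : ∀ m n → ι (m + n) ≡ ι m ℚ.+ ι n
ι-+ m n = trans
  (ℚ.fromℚᵘ-cong {mkℚᵘ (ℤ.+ (m + n)) 0} {mkℚᵘ (ℤ.+ m) 0 ℚᵘ.+ mkℚᵘ (ℤ.+ n) 0}
    (*≡* (cong (ℤ._* ℤ.+ 1) (sym (cong₂ ℤ._+_ (ℤ.*-identityʳ (ℤ.+ m)) (ℤ.*-identityʳ (ℤ.+ n)))))))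
  (fromℚᵘ-homo-+ (mkℚᵘ (ℤ.+ m) 0) (mkℚᵘ (ℤ.+ n) 0))

ι-* : ∀ m n → ι (m * n) ≡ ι m ℚ.* ι n
ι-* m n = trans
  (ℚ.fromℚᵘ-cong {mkℚᵘ (ℤ.+ (m * n)) 0} {mkℚᵘ (ℤ.+ m) 0 ℚᵘ.* mkℚᵘ (ℤ.+ n) 0}
    (*≡* (cong (ℤ._* ℤ.+ 1) (ℤ.pos-* m n))))
  (fromℚᵘ-homo-* (mkℚᵘ (ℤ.+ m) 0) (mkℚᵘ (ℤ.+ n) 0))

ι-Σ≤ : ∀ n f → ι (Σ≤ n f) ≡ Q.Σ≤ n (ι ∘ f)
ι-Σ≤ zero    f = refl
ι-Σ≤ (suc n) f = trans (ι-+ (Σ≤ n f) (f (suc n))) (cong (ℚ._+ ι (f (suc n))) (ι-Σ≤ n f))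

1/n*n≡1 : ∀ n .{{_ : NonZero n}} → ((ℤ.+ 1) / n) ℚ.* ι n ≡ 1ℚ
1/n*n≡1 n@(suc n-1) = trans
  (sym (fromℚᵘ-homo-* (mkℚᵘ (ℤ.+ 1) n-1) (mkℚᵘ (ℤ.+ n) 0)))
  (ℚ.fromℚᵘ-cong {mkℚᵘ (ℤ.+ 1) n-1 ℚᵘ.* mkℚᵘ (ℤ.+ n) 0} {mkℚᵘ (ℤ.+ 1) 0}
    (*≡* (cong ℤ.+_ (ring n-1))))
  where
  ring : ∀ m → (suc m + 0) * 1 ≡ suc m * 1 + 0
  ring = solve-∀

inv!-cancel : ∀ n → inv! n ℚ.* ι (n !) ≡ 1ℚ
inv!-cancel n = 1/n*n≡1 (n !) {{n !≢0}}

open CommutativeSemigroupProperties (CommutativeRing.*-commutativeSemigroup ℚ.+-*-commutativeRing)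
  using () renaming (x∙yz≈y∙xz to *-swapˡ; x∙yz≈xz∙y to *-swapʳ)

inv!-suc : ∀ n → ι (suc n) ℚ.* inv! (suc n) ≡ inv! n
inv!-suc n = begin
  ι (suc n) ℚ.* v                                ≡⟨ ℚ.*-identityʳ _ ⟨
  ι (suc n) ℚ.* v ℚ.* 1ℚ                         ≡⟨ cong (ι (suc n) ℚ.* v ℚ.*_) (inv!-cancel n) ⟨
  ι (suc n) ℚ.* v ℚ.* (u ℚ.* ι (n !))            ≡⟨ ring (ι (suc n)) v u (ι (n !)) ⟩
  v ℚ.* (ι (suc n) ℚ.* ι (n !)) ℚ.* u            ≡⟨ cong (λ x → v ℚ.* x ℚ.* u) (ι-* (suc n) (n !)) ⟨
  v ℚ.* ι (suc n !) ℚ.* u                        ≡⟨ cong (ℚ._* u) (inv!-cancel (suc n)) ⟩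
  1ℚ ℚ.* u                                       ≡⟨ ℚ.*-identityˡ u ⟩
  u                                              ∎
  where
  u = inv! n
  v = inv! (suc n)
  ring : ∀ a b c d → a ℚ.* b ℚ.* (c ℚ.* d) ≡ b ℚ.* (a ℚ.* d) ℚ.* c
  ring = solve 4 (λ a b c d → a :* b :* (c :* d) := b :* (a :* d) :* c) refl
    where open +-*-Solver

-- Formal power series and differentiation

sgn : ℕ → ℚ
sgn zero          = 1ℚ
sgn (suc zero)    = ℚ.- 1ℚ
sgn (suc (suc t)) = sgn t

-- The sign function of expNeg is local to Defs and cannot be named; the left-hand side of expNeg-sgn′
-- is inferred from its use, where `with` has replaced inv! j by a variable.
mutual
  expNeg-sgn′ : ∀ (j : ℕ) (x : ℚ) → _ ≡ sgn j ℚ.* x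
  expNeg-sgn : ∀ j → expNeg j ≡ sgn j ℚ.* inv! j
  expNeg-sgn j with inv! j
  ... | x = expNeg-sgn′ j x
  expNeg-sgn′ zero          x = refl
  expNeg-sgn′ (suc zero)    x = refl
  expNeg-sgn′ (suc (suc j)) x = expNeg-sgn′ j x

sgn-suc : ∀ n → sgn (suc n) ≡ ℚ.- sgn n
sgn-suc zero          = refl
sgn-suc (suc zero)    = refl
sgn-suc (suc (suc n)) = sgn-suc n

-- The formal derivative.
D : Series → Series
D a n = ι (suc n) ℚ.* a (suc n)

D-expNeg : ∀ n → D expNeg n ≡ ℚ.- expNeg n
D-expNeg n = begin
  ι (suc n) ℚ.* expNeg (suc n)                   ≡⟨ cong (ι (suc n) ℚ.*_) (expNeg-sgn (suc n)) ⟩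
  ι (suc n) ℚ.* (sgn (suc n) ℚ.* inv! (suc n))   ≡⟨ *-swapˡ (ι (suc n)) (sgn (suc n)) (inv! (suc n)) ⟩
  sgn (suc n) ℚ.* (ι (suc n) ℚ.* inv! (suc n))   ≡⟨ cong₂ ℚ._*_ (sgn-suc n) (inv!-suc n) ⟩
  ℚ.- sgn n ℚ.* inv! n                           ≡⟨ ℚ.neg-distribˡ-* (sgn n) (inv! n) ⟨
  ℚ.- (sgn n ℚ.* inv! n)                         ≡⟨ cong ℚ.-_ (expNeg-sgn n) ⟨
  ℚ.- expNeg n                                   ∎

⋆-Σ≤ : ∀ a b n → (a ⋆ b) n ≡ Q.Σ≤ n (λ j → a j ℚ.* b (n ∸ j))
⋆-Σ≤ a b n = ΣQ-Σ≤ n _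

⋆-congˡ : ∀ a {b b′} → b ≗ b′ → a ⋆ b ≗ a ⋆ b′
⋆-congˡ a {b} {b′} b≗b′ n = trans (⋆-Σ≤ a b n) (trans
  (Q.Σ≤-cong n λ j _ → cong (a j ℚ.*_) (b≗b′ (n ∸ j))) (sym (⋆-Σ≤ a b′ n)))

⋆-congʳ : ∀ b {a a′} → a ≗ a′ → a ⋆ b ≗ a′ ⋆ b
⋆-congʳ b {a} {a′} a≗a′ n = trans (⋆-Σ≤ a b n) (trans
  (Q.Σ≤-cong n λ j _ → cong (ℚ._* b (n ∸ j)) (a≗a′ j)) (sym (⋆-Σ≤ a′ b n)))

⋆-distribʳ : ∀ a b c n → ((λ j → a j ℚ.+ b j) ⋆ c) n ≡ (a ⋆ c) n ℚ.+ (b ⋆ c) n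
⋆-distribʳ a b c n = begin
  ((λ j → a j ℚ.+ b j) ⋆ c) n                      ≡⟨ ⋆-Σ≤ (λ j → a j ℚ.+ b j) c n ⟩
  Q.Σ≤ n (λ j → (a j ℚ.+ b j) ℚ.* c (n ∸ j))
    ≡⟨ Q.Σ≤-cong n (λ j _ → ℚ.*-distribʳ-+ (c (n ∸ j)) (a j) (b j)) ⟩
  Q.Σ≤ n (λ j → a j ℚ.* c (n ∸ j) ℚ.+ b j ℚ.* c (n ∸ j)) ≡⟨ Q.Σ≤-+ n _ _ ⟩
  _                                                ≡⟨ cong₂ ℚ._+_ (⋆-Σ≤ a c n) (⋆-Σ≤ b c n) ⟨
  (a ⋆ c) n ℚ.+ (b ⋆ c) n                          ∎

⋆-distribˡ : ∀ a b c n → (a ⋆ (λ j → b j ℚ.+ c j)) n ≡ (a ⋆ b) n ℚ.+ (a ⋆ c) n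
⋆-distribˡ a b c n = begin
  (a ⋆ (λ j → b j ℚ.+ c j)) n                      ≡⟨ ⋆-Σ≤ a (λ j → b j ℚ.+ c j) n ⟩
  Q.Σ≤ n (λ j → a j ℚ.* (b (n ∸ j) ℚ.+ c (n ∸ j)))
    ≡⟨ Q.Σ≤-cong n (λ j _ → ℚ.*-distribˡ-+ (a j) (b (n ∸ j)) (c (n ∸ j))) ⟩
  Q.Σ≤ n (λ j → a j ℚ.* b (n ∸ j) ℚ.+ a j ℚ.* c (n ∸ j)) ≡⟨ Q.Σ≤-+ n _ _ ⟩
  _                                                ≡⟨ cong₂ ℚ._+_ (⋆-Σ≤ a b n) (⋆-Σ≤ a c n) ⟨
  (a ⋆ b) n ℚ.+ (a ⋆ c) n                          ∎

⋆-scaleʳ : ∀ x a b n → (a ⋆ (λ j → x ℚ.* b j)) n ≡ x ℚ.* (a ⋆ b) n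
⋆-scaleʳ x a b n = begin
  (a ⋆ (λ j → x ℚ.* b j)) n                 ≡⟨ ⋆-Σ≤ a (λ j → x ℚ.* b j) n ⟩
  Q.Σ≤ n (λ j → a j ℚ.* (x ℚ.* b (n ∸ j)))  ≡⟨ Q.Σ≤-cong n (λ j _ → *-swapˡ (a j) x (b (n ∸ j))) ⟩
  Q.Σ≤ n (λ j → x ℚ.* (a j ℚ.* b (n ∸ j)))  ≡⟨ Q.Σ≤-*ˡ n x _ ⟩
  x ℚ.* Q.Σ≤ n (λ j → a j ℚ.* b (n ∸ j))    ≡⟨ cong (x ℚ.*_) (⋆-Σ≤ a b n) ⟨
  x ℚ.* (a ⋆ b) n                           ∎

⋆-identityˡ : ∀ b n → (oneS ⋆ b) n ≡ b n
⋆-identityˡ b n = trans (⋆-Σ≤ oneS b n) (go n)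
  where
  go : ∀ n → Q.Σ≤ n (λ j → oneS j ℚ.* b (n ∸ j)) ≡ b n
  go zero    = ℚ.*-identityˡ (b 0)
  go (suc n) = begin
    Q.Σ≤ (suc n) (λ j → oneS j ℚ.* b (suc n ∸ j))                    ≡⟨ Q.Σ≤-head n _ ⟩
    1ℚ ℚ.* b (suc n) ℚ.+ Q.Σ≤ n (λ j → 0ℚ ℚ.* b (n ∸ j))
      ≡⟨ cong₂ ℚ._+_ (ℚ.*-identityˡ (b (suc n))) (Q.Σ≤-*ˡ n 0ℚ (λ j → b (n ∸ j))) ⟩
    b (suc n) ℚ.+ 0ℚ ℚ.* Q.Σ≤ n (λ j → b (n ∸ j))
      ≡⟨ cong (b (suc n) ℚ.+_) (ℚ.*-zeroˡ (Q.Σ≤ n (λ j → b (n ∸ j)))) ⟩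
    b (suc n) ℚ.+ 0ℚ                                                 ≡⟨ ℚ.+-identityʳ (b (suc n)) ⟩
    b (suc n)                                                        ∎

-- Leibniz rule: the factor `n + 1` splits as `j + (n + 1 - j)`, one part for each series; the first
-- part vanishes at `j = 0`, the second at `j = n + 1`.
D-⋆ : ∀ a b n → D (a ⋆ b) n ≡ (D a ⋆ b) n ℚ.+ (a ⋆ D b) n
D-⋆ a b n = begin
  ι (suc n) ℚ.* (a ⋆ b) (suc n)
    ≡⟨ cong (ι (suc n) ℚ.*_) (⋆-Σ≤ a b (suc n)) ⟩
  ι (suc n) ℚ.* Q.Σ≤ (suc n) (λ j → a j ℚ.* b (suc n ∸ j))
    ≡⟨ Q.Σ≤-*ˡ (suc n) (ι (suc n)) _ ⟨
  Q.Σ≤ (suc n) (λ j → ι (suc n) ℚ.* (a j ℚ.* b (suc n ∸ j)))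
    ≡⟨ Q.Σ≤-cong (suc n) split ⟩
  Q.Σ≤ (suc n) (λ j → L j ℚ.+ H j)
    ≡⟨ Q.Σ≤-+ (suc n) L H ⟩
  Q.Σ≤ (suc n) L ℚ.+ Q.Σ≤ (suc n) H
    ≡⟨ cong₂ ℚ._+_ left right ⟩
  (D a ⋆ b) n ℚ.+ (a ⋆ D b) n ∎
  where
  L H : ℕ → ℚ
  L j = ι j ℚ.* a j ℚ.* b (suc n ∸ j)
  H j = a j ℚ.* (ι (suc n ∸ j) ℚ.* b (suc n ∸ j))

  split : ∀ j → j ≤ suc n → ι (suc n) ℚ.* (a j ℚ.* b (suc n ∸ j)) ≡ L j ℚ.+ H j
  split j j≤1+n = begin
    ι (suc n) ℚ.* (a j ℚ.* y)             ≡⟨ cong (λ m → ι m ℚ.* (a j ℚ.* y)) (m+[n∸m]≡n j≤1+n) ⟨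
    ι (j + (suc n ∸ j)) ℚ.* (a j ℚ.* y)   ≡⟨ cong (ℚ._* (a j ℚ.* y)) (ι-+ j (suc n ∸ j)) ⟩
    (ι j ℚ.+ ι (suc n ∸ j)) ℚ.* (a j ℚ.* y) ≡⟨ ring (ι j) (ι (suc n ∸ j)) (a j) y ⟩
    L j ℚ.+ H j                           ∎
    where
    y = b (suc n ∸ j)
    ring : ∀ p q x y → (p ℚ.+ q) ℚ.* (x ℚ.* y) ≡ p ℚ.* x ℚ.* y ℚ.+ x ℚ.* (q ℚ.* y)
    ring = solve 4 (λ p q x y → (p :+ q) :* (x :* y) := p :* x :* y :+ x :* (q :* y)) refl
      where open +-*-Solver

  left : Q.Σ≤ (suc n) L ≡ (D a ⋆ b) n
  left = begin
    Q.Σ≤ (suc n) L                     ≡⟨ Q.Σ≤-head n L ⟩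
    L 0 ℚ.+ Q.Σ≤ n (λ j → L (suc j))   ≡⟨ cong (ℚ._+ Q.Σ≤ n (λ j → L (suc j))) L0 ⟩
    0ℚ ℚ.+ Q.Σ≤ n (λ j → L (suc j))    ≡⟨ ℚ.+-identityˡ _ ⟩
    Q.Σ≤ n (λ j → L (suc j))           ≡⟨ ⋆-Σ≤ (D a) b n ⟨
    (D a ⋆ b) n                        ∎
    where
    L0 : L 0 ≡ 0ℚ
    L0 = trans (cong (ℚ._* b (suc n)) (ℚ.*-zeroˡ (a 0))) (ℚ.*-zeroˡ (b (suc n)))

  right : Q.Σ≤ (suc n) H ≡ (a ⋆ D b) n
  right = begin
    Q.Σ≤ n H ℚ.+ H (suc n)
      ≡⟨ cong₂ ℚ._+_ (Q.Σ≤-cong n λ j j≤n → cong (λ m → a j ℚ.* (ι m ℚ.* b m)) (+-∸-assoc 1 j≤n)) top ⟩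
    S ℚ.+ 0ℚ                ≡⟨ ℚ.+-identityʳ S ⟩
    S                       ≡⟨ ⋆-Σ≤ a (D b) n ⟨
    (a ⋆ D b) n             ∎
    where
    S = Q.Σ≤ n (λ j → a j ℚ.* D b (n ∸ j))
    top : H (suc n) ≡ 0ℚ
    top rewrite n∸n≡0 n = trans (cong (a (suc n) ℚ.*_) (ℚ.*-zeroˡ (b 0))) (ℚ.*-zeroʳ (a (suc n)))

1-e⁻ˣ : Series
1-e⁻ˣ = oneMinusExpNeg

-- The differential equation `f′ = 1 - f` of `f = 1 - e⁻ˣ`.
D-1-e⁻ˣ : ∀ n → D 1-e⁻ˣ n ℚ.+ 1-e⁻ˣ n ≡ oneS n
D-1-e⁻ˣ n = begin
  ι (suc n) ℚ.* (0ℚ ℚ.- expNeg (suc n)) ℚ.+ (oneS n ℚ.- expNeg n)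
    ≡⟨ ring (ι (suc n)) (expNeg (suc n)) (oneS n) (expNeg n) ⟩
  oneS n ℚ.- (D expNeg n ℚ.+ expNeg n)
    ≡⟨ cong (λ x → oneS n ℚ.- (x ℚ.+ expNeg n)) (D-expNeg n) ⟩
  oneS n ℚ.- (ℚ.- expNeg n ℚ.+ expNeg n)
    ≡⟨ cong (λ x → oneS n ℚ.- x) (ℚ.+-inverseˡ (expNeg n)) ⟩
  oneS n ℚ.- 0ℚ                                                   ≡⟨ ℚ.+-identityʳ (oneS n) ⟩
  oneS n                                                          ∎
  where
  ring : ∀ i e o d → i ℚ.* (0ℚ ℚ.- e) ℚ.+ (o ℚ.- d) ≡ o ℚ.- (i ℚ.* e ℚ.+ d)
  ring = solve 4 (λ i e o d → i :* (con 0ℚ :- e) :+ (o :- d) := o :- (i :* e :+ d)) refl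
    where open +-*-Solver

-- For `i > 0` this is `D-pow` for the exponent `i`, multiplied by `f = 1 - e⁻ˣ`. The extra factor
-- replaces `fⁱ⁻¹` by `fⁱ`, so that `i = 0` makes sense and can start the joint induction with the
-- Leibniz rule.
⋆-D-pow : ∀ i n → (1-e⁻ˣ ⋆ D (1-e⁻ˣ ^S i)) n ℚ.+ ι i ℚ.* (1-e⁻ˣ ^S suc i) n ≡ ι i ℚ.* (1-e⁻ˣ ^S i) n
D-pow : ∀ i n → D (1-e⁻ˣ ^S suc i) n ℚ.+ ι (suc i) ℚ.* (1-e⁻ˣ ^S suc i) n ≡ ι (suc i) ℚ.* (1-e⁻ˣ ^S i) n

⋆-D-pow zero n = begin
  (1-e⁻ˣ ⋆ D oneS) n ℚ.+ 0ℚ ℚ.* (1-e⁻ˣ ^S 1) n        ≡⟨ cong₂ ℚ._+_ vanish (ℚ.*-zeroˡ ((1-e⁻ˣ ^S 1) n)) ⟩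
  0ℚ ℚ.+ 0ℚ                                    ≡⟨ ℚ.*-zeroˡ (oneS n) ⟨
  0ℚ ℚ.* oneS n                                ∎
  where
  vanish : (1-e⁻ˣ ⋆ D oneS) n ≡ 0ℚ
  vanish = begin
    (1-e⁻ˣ ⋆ D oneS) n
      ≡⟨ ⋆-congˡ 1-e⁻ˣ (λ j → trans (ℚ.*-zeroʳ (ι (suc j))) (sym (ℚ.*-zeroˡ (1-e⁻ˣ j)))) n ⟩
    (1-e⁻ˣ ⋆ (λ j → 0ℚ ℚ.* 1-e⁻ˣ j)) n     ≡⟨ ⋆-scaleʳ 0ℚ 1-e⁻ˣ 1-e⁻ˣ n ⟩
    0ℚ ℚ.* (1-e⁻ˣ ⋆ 1-e⁻ˣ) n               ≡⟨ ℚ.*-zeroˡ ((1-e⁻ˣ ⋆ 1-e⁻ˣ) n) ⟩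
    0ℚ                             ∎
⋆-D-pow (suc i) n = begin
  (1-e⁻ˣ ⋆ D g) n ℚ.+ ι (suc i) ℚ.* (1-e⁻ˣ ⋆ g) n
    ≡⟨ cong ((1-e⁻ˣ ⋆ D g) n ℚ.+_) (⋆-scaleʳ (ι (suc i)) 1-e⁻ˣ g n) ⟨
  (1-e⁻ˣ ⋆ D g) n ℚ.+ (1-e⁻ˣ ⋆ (λ j → ι (suc i) ℚ.* g j)) n
    ≡⟨ ⋆-distribˡ 1-e⁻ˣ (D g) (λ j → ι (suc i) ℚ.* g j) n ⟨
  (1-e⁻ˣ ⋆ (λ j → D g j ℚ.+ ι (suc i) ℚ.* g j)) n        ≡⟨ ⋆-congˡ 1-e⁻ˣ (D-pow i) n ⟩
  (1-e⁻ˣ ⋆ (λ j → ι (suc i) ℚ.* (1-e⁻ˣ ^S i) j)) n           ≡⟨ ⋆-scaleʳ (ι (suc i)) 1-e⁻ˣ (1-e⁻ˣ ^S i) n ⟩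
  ι (suc i) ℚ.* g n                                  ∎
  where g = 1-e⁻ˣ ^S suc i

D-pow i n = begin
  D (1-e⁻ˣ ⋆ g) n ℚ.+ ι (suc i) ℚ.* (1-e⁻ˣ ⋆ g) n
    ≡⟨ cong₂ (λ x y → x ℚ.+ y ℚ.* (1-e⁻ˣ ⋆ g) n) (D-⋆ 1-e⁻ˣ g n) (ι-+ 1 i) ⟩
  (D 1-e⁻ˣ ⋆ g) n ℚ.+ (1-e⁻ˣ ⋆ D g) n ℚ.+ (1ℚ ℚ.+ ι i) ℚ.* (1-e⁻ˣ ⋆ g) n
    ≡⟨ ring₁ ((D 1-e⁻ˣ ⋆ g) n) ((1-e⁻ˣ ⋆ D g) n) (ι i) ((1-e⁻ˣ ⋆ g) n) ⟩
  ((D 1-e⁻ˣ ⋆ g) n ℚ.+ (1-e⁻ˣ ⋆ g) n) ℚ.+ ((1-e⁻ˣ ⋆ D g) n ℚ.+ ι i ℚ.* (1-e⁻ˣ ⋆ g) n)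
    ≡⟨ cong₂ ℚ._+_ (sym (⋆-distribʳ (D 1-e⁻ˣ) 1-e⁻ˣ g n)) (⋆-D-pow i n) ⟩
  ((λ j → D 1-e⁻ˣ j ℚ.+ 1-e⁻ˣ j) ⋆ g) n ℚ.+ ι i ℚ.* g n
    ≡⟨ cong (ℚ._+ ι i ℚ.* g n) (trans (⋆-congʳ g D-1-e⁻ˣ n) (⋆-identityˡ g n)) ⟩
  g n ℚ.+ ι i ℚ.* g n
    ≡⟨ ring₂ (ι i) (g n) ⟩
  (1ℚ ℚ.+ ι i) ℚ.* g n
    ≡⟨ cong (ℚ._* g n) (ι-+ 1 i) ⟨
  ι (suc i) ℚ.* g n ∎
  where
  open +-*-Solver
  g = 1-e⁻ˣ ^S i
  ring₁ : ∀ a b c d → a ℚ.+ b ℚ.+ (1ℚ ℚ.+ c) ℚ.* d ≡ (a ℚ.+ d) ℚ.+ (b ℚ.+ c ℚ.* d)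
  ring₁ = solve 4 (λ a b c d → a :+ b :+ (con 1ℚ :+ c) :* d := (a :+ d) :+ (b :+ c :* d)) refl
  ring₂ : ∀ c d → d ℚ.+ c ℚ.* d ≡ (1ℚ ℚ.+ c) ℚ.* d
  ring₂ = solve 2 (λ c d → d :+ c :* d := (con 1ℚ :+ c) :* d) refl

-- The numbers `P n i` and binomial expansions

P : ℕ → ℕ → ℚ
P n i = ι (n !) ℚ.* (1-e⁻ˣ ^S i) n

P-zero-suc : ∀ i → P 0 (suc i) ≡ 0ℚ
P-zero-suc i = trans (cong (1ℚ ℚ.*_) (ℚ.*-zeroˡ ((1-e⁻ˣ ^S i) 0))) (ℚ.*-zeroʳ 1ℚ)

P-suc-zero : ∀ n → P (suc n) 0 ≡ 0ℚ
P-suc-zero n = ℚ.*-zeroʳ (ι (suc n !))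

P-suc-suc : ∀ n i → P (suc n) (suc i) ℚ.+ ι (suc i) ℚ.* P n (suc i) ≡ ι (suc i) ℚ.* P n i
P-suc-suc n i = begin
  ι (suc n !) ℚ.* g (suc n) ℚ.+ ι (suc i) ℚ.* (ι (n !) ℚ.* g n)
    ≡⟨ cong (λ x → x ℚ.* g (suc n) ℚ.+ ι (suc i) ℚ.* (ι (n !) ℚ.* g n)) (ι-* (suc n) (n !)) ⟩
  ι (suc n) ℚ.* ι (n !) ℚ.* g (suc n) ℚ.+ ι (suc i) ℚ.* (ι (n !) ℚ.* g n)
    ≡⟨ ring (ι (suc n)) (ι (n !)) (g (suc n)) (ι (suc i)) (g n) ⟩
  ι (n !) ℚ.* (D g n ℚ.+ ι (suc i) ℚ.* g n)
    ≡⟨ cong (ι (n !) ℚ.*_) (D-pow i n) ⟩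
  ι (n !) ℚ.* (ι (suc i) ℚ.* (1-e⁻ˣ ^S i) n)
    ≡⟨ *-swapˡ (ι (n !)) (ι (suc i)) _ ⟩
  ι (suc i) ℚ.* P n i ∎
  where
  g = 1-e⁻ˣ ^S suc i
  ring : ∀ a b c d e → a ℚ.* b ℚ.* c ℚ.+ d ℚ.* (b ℚ.* e) ≡ b ℚ.* (a ℚ.* c ℚ.+ d ℚ.* e)
  ring = solve 5 (λ a b c d e → a :* b :* c :+ d :* (b :* e) := b :* (a :* c :+ d :* e)) refl
    where open +-*-Solver

P-vanish : ∀ n i → n < i → P n i ≡ 0ℚ
P-vanish zero    (suc i) _         = P-zero-suc i
P-vanish (suc n) (suc i) (s≤s n<i) = begin
  P (suc n) (suc i)                                  ≡⟨ ℚ.+-identityʳ _ ⟨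
  P (suc n) (suc i) ℚ.+ 0ℚ
    ≡⟨ cong (P (suc n) (suc i) ℚ.+_) (zeroAt (suc i) (m<n⇒m<1+n n<i)) ⟨
  P (suc n) (suc i) ℚ.+ ι (suc i) ℚ.* P n (suc i)    ≡⟨ P-suc-suc n i ⟩
  ι (suc i) ℚ.* P n i                                ≡⟨ zeroAt i n<i ⟩
  0ℚ                                                 ∎
  where
  zeroAt : ∀ j → n < j → ι (suc i) ℚ.* P n j ≡ 0ℚ
  zeroAt j n<j = trans (cong (ι (suc i) ℚ.*_) (P-vanish n j n<j)) (ℚ.*-zeroʳ (ι (suc i)))

-- Summation by parts moves the recurrence of `P` onto the weight: `c i` against `P (suc n)` becomes
-- `(i + 1) c (i + 1) - i c i` against `P n`. The boundary terms at 0 and `suc n` vanish.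
P-moment-suc : ∀ n (c : ℕ → ℕ) →
  Q.Σ≤ (suc n) (λ i → P (suc n) i ℚ.* ι (c i)) ℚ.+ Q.Σ≤ n (λ i → P n i ℚ.* ι (i * c i))
    ≡ Q.Σ≤ n (λ i → P n i ℚ.* ι (suc i * c (suc i)))
P-moment-suc n c = begin
  Q.Σ≤ (suc n) (λ i → P (suc n) i ℚ.* ι (c i)) ℚ.+ Q.Σ≤ n G
    ≡⟨ cong₂ ℚ._+_ first (sym (Q.Σ≤-shift n G G0 G-top)) ⟩
  Q.Σ≤ n (λ i → P (suc n) (suc i) ℚ.* ι (c (suc i))) ℚ.+ Q.Σ≤ n (λ i → G (suc i))
    ≡⟨ Q.Σ≤-+ n _ _ ⟨
  Q.Σ≤ n (λ i → P (suc n) (suc i) ℚ.* ι (c (suc i)) ℚ.+ G (suc i))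
    ≡⟨ Q.Σ≤-cong n (λ i _ → pointwise i) ⟩
  Q.Σ≤ n (λ i → P n i ℚ.* ι (suc i * c (suc i))) ∎
  where
  open +-*-Solver
  G : ℕ → ℚ
  G i = P n i ℚ.* ι (i * c i)
  G0 : G 0 ≡ 0ℚ
  G0 = ℚ.*-zeroʳ (P n 0)
  G-top : G (suc n) ≡ 0ℚ
  G-top = trans (cong (ℚ._* ι (suc n * c (suc n))) (P-vanish n (suc n) ≤-refl)) (ℚ.*-zeroˡ (ι (suc n * c (suc n))))
  first : Q.Σ≤ (suc n) (λ i → P (suc n) i ℚ.* ι (c i)) ≡ Q.Σ≤ n (λ i → P (suc n) (suc i) ℚ.* ι (c (suc i)))
  first = trans (Q.Σ≤-head n _) (trans
    (cong (ℚ._+ Q.Σ≤ n (λ i → P (suc n) (suc i) ℚ.* ι (c (suc i))))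
      (trans (cong (ℚ._* ι (c 0)) (P-suc-zero n)) (ℚ.*-zeroˡ (ι (c 0)))))
    (ℚ.+-identityˡ _))
  ring₁ : ∀ a x b e → a ℚ.* x ℚ.+ b ℚ.* (e ℚ.* x) ≡ (a ℚ.+ e ℚ.* b) ℚ.* x
  ring₁ = solve 4 (λ a x b e → a :* x :+ b :* (e :* x) := (a :+ e :* b) :* x) refl
  ring₂ : ∀ e b x → e ℚ.* b ℚ.* x ≡ b ℚ.* (e ℚ.* x)
  ring₂ = solve 3 (λ e b x → e :* b :* x := b :* (e :* x)) refl
  pointwise : ∀ i → P (suc n) (suc i) ℚ.* ι (c (suc i)) ℚ.+ G (suc i) ≡ P n i ℚ.* ι (suc i * c (suc i))
  pointwise i = begin
    a ℚ.* x ℚ.+ b ℚ.* ι (suc i * c (suc i))   ≡⟨ cong (λ y → a ℚ.* x ℚ.+ b ℚ.* y) (ι-* (suc i) (c (suc i))) ⟩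
    a ℚ.* x ℚ.+ b ℚ.* (e ℚ.* x)               ≡⟨ ring₁ a x b e ⟩
    (a ℚ.+ e ℚ.* b) ℚ.* x                     ≡⟨ cong (ℚ._* x) (P-suc-suc n i) ⟩
    e ℚ.* P n i ℚ.* x                         ≡⟨ ring₂ e (P n i) x ⟩
    P n i ℚ.* (e ℚ.* x)                       ≡⟨ cong (P n i ℚ.*_) (ι-* (suc i) (c (suc i))) ⟨
    P n i ℚ.* ι (suc i * c (suc i))           ∎
    where
    a = P (suc n) (suc i)
    b = P n (suc i)
    e = ι (suc i)
    x = ι (c (suc i))

-- Equivalent to `(i - m) C(i, m) = (m + 1) C(i, m + 1)`: the rule that defines `T`, at a natural
-- argument.
C-absorb : ∀ i m → i * (i C m) ≡ m * (i C m) + suc m * (i C suc m)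
-- The forward difference of `i C(i, m + 1)`; its coefficients `m + 2` and `m + 1` are those in the
-- recursion for `T 0 (suc n) (suc m)`.
C-suc : ∀ i m → suc i * (suc i C suc m) ≡ i * (i C suc m) + (suc (suc m) * (i C suc m) + suc m * (i C m))
C-suc i m rewrite sym (nCk+nC[k+1]≡[n+1]C[k+1] i m) = begin
  suc i * (x + y)                        ≡⟨ ring₁ i x y ⟩
  i * x + (x + (i * y + y))              ≡⟨ cong (_+ (x + (i * y + y))) (C-absorb i m) ⟩
  m * x + suc m * y + (x + (i * y + y))  ≡⟨ ring₂ i m x y ⟩
  i * y + (suc (suc m) * y + suc m * x)  ∎
  where
  x = i C m
  y = i C suc m
  ring₁ : ∀ i x y → suc i * (x + y) ≡ i * x + (x + (i * y + y))
  ring₁ = solve-∀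
  ring₂ : ∀ i m x y → m * x + suc m * y + (x + (i * y + y)) ≡ i * y + (suc (suc m) * y + suc m * x)
  ring₂ = solve-∀
C-absorb zero    zero    = refl
C-absorb zero    (suc m) = sym (cong₂ _+_ (*-zeroʳ m) (*-zeroʳ m))
C-absorb (suc i) zero    rewrite sym (nCk+nC[k+1]≡[n+1]C[k+1] i 0) = begin
  suc i * 1             ≡⟨⟩
  suc (i * 1)           ≡⟨ cong suc (C-absorb i 0) ⟩
  suc (1 * (i C 1))     ≡⟨ cong suc (+-identityʳ (i C 1)) ⟩
  suc (i C 1)           ≡⟨ +-identityʳ _ ⟨
  suc (i C 1) + 0       ∎
C-absorb (suc i) (suc m) = begin
  suc i * (suc i C suc m)                ≡⟨ C-suc i m ⟩
  i * y + (suc (suc m) * y + suc m * x)  ≡⟨ cong (_+ (suc (suc m) * y + suc m * x)) (C-absorb i (suc m)) ⟩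
  suc m * y + suc (suc m) * z + (suc (suc m) * y + suc m * x) ≡⟨ ring m x y z ⟩
  suc m * (x + y) + suc (suc m) * (y + z) ≡⟨ cong₂ (λ u v → suc m * u + suc (suc m) * v)
                                             (nCk+nC[k+1]≡[n+1]C[k+1] i m) (nCk+nC[k+1]≡[n+1]C[k+1] i (suc m)) ⟩
  suc m * (suc i C suc m) + suc (suc m) * (suc i C suc (suc m)) ∎
  where
  x = i C m
  y = i C suc m
  z = i C suc (suc m)
  ring : ∀ m x y z → suc m * y + suc (suc m) * z + (suc (suc m) * y + suc m * x) ≡ suc m * (x + y) + suc (suc m) * (y + z)
  ring = solve-∀

-- For the weight `C(i, m)`, summation by parts and `C-suc` give the recursion of `T 0 n m` in `n`,
-- up to a summand `G` common to both sides, which cancels.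
P-binomial : ∀ n m → Q.Σ≤ n (λ i → P n i ℚ.* ι (i C m)) ≡ ι (T 0 n m)
P-binomial zero    zero    = refl
P-binomial zero    (suc m) = refl
P-binomial (suc n) zero    = ℚ-cancelʳ _ _ _ (begin
  S ℚ.+ G                                         ≡⟨ P-moment-suc n (_C 0) ⟩
  Q.Σ≤ n (λ i → P n i ℚ.* ι (suc i * 1))
    ≡⟨ Q.Σ≤-cong n (λ i _ → trans (cong (P n i ℚ.*_) (ι-+ 1 (i * 1))) (ℚ.*-distribˡ-+ (P n i) 1ℚ (ι (i * 1)))) ⟩
  Q.Σ≤ n (λ i → P n i ℚ.* 1ℚ ℚ.+ P n i ℚ.* ι (i * 1))
    ≡⟨ Q.Σ≤-+ n (λ i → P n i ℚ.* ι (i C 0)) (λ i → P n i ℚ.* ι (i * 1)) ⟩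
  Q.Σ≤ n (λ i → P n i ℚ.* ι (i C 0)) ℚ.+ G        ≡⟨ cong (ℚ._+ G) (P-binomial n 0) ⟩
  ι (T 0 n 0) ℚ.+ G                               ∎)
  where
  S = Q.Σ≤ (suc n) (λ i → P (suc n) i ℚ.* ι (i C 0))
  G = Q.Σ≤ n (λ i → P n i ℚ.* ι (i * (i C 0)))
P-binomial (suc n) (suc m) = ℚ-cancelʳ _ _ _ (begin
  S ℚ.+ G                                         ≡⟨ P-moment-suc n (_C suc m) ⟩
  Q.Σ≤ n (λ i → P n i ℚ.* ι (suc i * (suc i C suc m))) ≡⟨ Q.Σ≤-cong n (λ i _ → pointwise i) ⟩
  Q.Σ≤ n (λ i → u ℚ.* (P n i ℚ.* ι (i C suc m)) ℚ.+ v ℚ.* (P n i ℚ.* ι (i C m)) ℚ.+ P n i ℚ.* ι (i * (i C suc m)))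
    ≡⟨ trans (Q.Σ≤-+ n _ _) (cong (ℚ._+ G) (trans (Q.Σ≤-+ n _ _) (cong₂ ℚ._+_ (Q.Σ≤-*ˡ n u _) (Q.Σ≤-*ˡ n v _)))) ⟩
  u ℚ.* Q.Σ≤ n (λ i → P n i ℚ.* ι (i C suc m)) ℚ.+ v ℚ.* Q.Σ≤ n (λ i → P n i ℚ.* ι (i C m)) ℚ.+ G
    ≡⟨ cong (ℚ._+ G) (cong₂ (λ x y → u ℚ.* x ℚ.+ v ℚ.* y) (P-binomial n (suc m)) (P-binomial n m)) ⟩
  u ℚ.* ι (T 0 n (suc m)) ℚ.+ v ℚ.* ι (T 0 n m) ℚ.+ G
    ≡⟨ cong (ℚ._+ G) (ι-linear (suc (suc m)) (T 0 n (suc m)) (suc m) (T 0 n m)) ⟨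
  ι (T 0 (suc n) (suc m)) ℚ.+ G ∎)
  where
  S = Q.Σ≤ (suc n) (λ i → P (suc n) i ℚ.* ι (i C suc m))
  G = Q.Σ≤ n (λ i → P n i ℚ.* ι (i * (i C suc m)))
  u = ι (suc (suc m))
  v = ι (suc m)
  ι-linear : ∀ a x b y → ι (a * x + b * y) ≡ ι a ℚ.* ι x ℚ.+ ι b ℚ.* ι y
  ι-linear a x b y = trans (ι-+ (a * x) (b * y)) (cong₂ ℚ._+_ (ι-* a x) (ι-* b y))
  ring : ∀ p c u x v y → p ℚ.* (c ℚ.+ (u ℚ.* x ℚ.+ v ℚ.* y)) ≡ u ℚ.* (p ℚ.* x) ℚ.+ v ℚ.* (p ℚ.* y) ℚ.+ p ℚ.* c
  ring = solve 6 (λ p c u x v y → p :* (c :+ (u :* x :+ v :* y)) := u :* (p :* x) :+ v :* (p :* y) :+ p :* c) refl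
    where open +-*-Solver
  pointwise : ∀ i → P n i ℚ.* ι (suc i * (suc i C suc m)) ≡
    u ℚ.* (P n i ℚ.* ι (i C suc m)) ℚ.+ v ℚ.* (P n i ℚ.* ι (i C m)) ℚ.+ P n i ℚ.* ι (i * (i C suc m))
  pointwise i = begin
    P n i ℚ.* ι (suc i * (suc i C suc m))
      ≡⟨ cong (λ x → P n i ℚ.* ι x) (C-suc i m) ⟩
    P n i ℚ.* ι (i * (i C suc m) + (suc (suc m) * (i C suc m) + suc m * (i C m)))
      ≡⟨ cong (P n i ℚ.*_) (trans (ι-+ (i * (i C suc m)) _)
           (cong (ι (i * (i C suc m)) ℚ.+_) (ι-linear (suc (suc m)) (i C suc m) (suc m) (i C m)))) ⟩
    P n i ℚ.* (ι (i * (i C suc m)) ℚ.+ (u ℚ.* ι (i C suc m) ℚ.+ v ℚ.* ι (i C m)))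
      ≡⟨ ring (P n i) _ u _ v _ ⟩
    u ℚ.* (P n i ℚ.* ι (i C suc m)) ℚ.+ v ℚ.* (P n i ℚ.* ι (i C m)) ℚ.+ P n i ℚ.* ι (i * (i C suc m)) ∎

-- The expansion of `(x + 1)ᵏ` at `x = i`. Since `C(i, m) = 0` for `m > i`, the range need only
-- reach `i`, whatever `k` is.
power-T : ∀ R i k → i ≤ R → suc i ^ k ≡ Σ≤ R (λ m → (i C m) * T 0 k m)
power-T R i zero    i≤R = Σ≤-extend 0 R z≤n λ { (suc m) _ → *-zeroʳ (i C suc m) }
power-T R i (suc k) i≤R = begin
  suc i * suc i ^ k
    ≡⟨ cong (suc i *_) (power-T R i k i≤R) ⟩
  suc i * Σ≤ R (λ m → (i C m) * T 0 k m)
    ≡⟨ Σ≤-*ˡ R (suc i) _ ⟨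
  Σ≤ R (λ m → suc i * ((i C m) * T 0 k m))
    ≡⟨ Σ≤-cong R (λ m _ → raise m) ⟩
  Σ≤ R (λ m → suc m * (i C m) * T 0 k m + E (suc m))
    ≡⟨ trans (Σ≤-+ R _ _) (cong (Σ≤ R (λ m → suc m * (i C m) * T 0 k m) +_) (Σ≤-shift R E refl E-top)) ⟩
  Σ≤ R (λ m → suc m * (i C m) * T 0 k m) + Σ≤ R E
    ≡⟨ Σ≤-+ R _ _ ⟨
  Σ≤ R (λ m → suc m * (i C m) * T 0 k m + E m)
    ≡⟨ Σ≤-cong R (λ m _ → collect m) ⟩
  Σ≤ R (λ m → (i C m) * T 0 (suc k) m) ∎
  where
  -- `E (suc m)` is the part of the term at `m` that multiplication by `i + 1` moves up to
  -- `C(i, m + 1)`.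
  E : ℕ → ℕ
  E zero    = 0
  E (suc m) = suc m * (i C suc m) * T 0 k m
  E-top : E (suc R) ≡ 0
  E-top rewrite k>n⇒nCk≡0 (s≤s i≤R) | *-zeroʳ R = refl
  raise : ∀ m → suc i * ((i C m) * T 0 k m) ≡ suc m * (i C m) * T 0 k m + E (suc m)
  raise m = begin
    suc i * (x * t)                    ≡⟨ ring₁ i x t ⟩
    (x + i * x) * t                    ≡⟨ cong (λ z → (x + z) * t) (C-absorb i m) ⟩
    (x + (m * x + suc m * y)) * t      ≡⟨ ring₂ m x y t ⟩
    suc m * x * t + suc m * y * t      ∎
    where
    x = i C m
    y = i C suc m
    t = T 0 k m
    ring₁ : ∀ i x t → suc i * (x * t) ≡ (x + i * x) * t
    ring₁ = solve-∀
    ring₂ : ∀ m x y t → (x + (m * x + suc m * y)) * t ≡ suc m * x * t + suc m * y * t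
    ring₂ = solve-∀
  collect : ∀ m → suc m * (i C m) * T 0 k m + E m ≡ (i C m) * T 0 (suc k) m
  collect zero    = +-identityʳ _
  collect (suc m) = ring m (i C suc m) (T 0 k (suc m)) (T 0 k m)
    where
    ring : ∀ m x s t → suc (suc m) * x * s + suc m * x * t ≡ x * (suc (suc m) * s + suc m * t)
    ring = solve-∀

polyBernoulli-T : ∀ n k → B n k ≡ ι (Σ≤ n (λ m → T 0 n m * T 0 k m))
polyBernoulli-T n k = begin
  ι (n !) ℚ.* ΣQ[0‥ n ] (λ i → ι (suc i ^ k) ℚ.* (1-e⁻ˣ ^S i) n)
    ≡⟨ cong (ι (n !) ℚ.*_) (ΣQ-Σ≤ n _) ⟩
  ι (n !) ℚ.* Q.Σ≤ n (λ i → ι (suc i ^ k) ℚ.* (1-e⁻ˣ ^S i) n)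
    ≡⟨ Q.Σ≤-*ˡ n (ι (n !)) _ ⟨
  Q.Σ≤ n (λ i → ι (n !) ℚ.* (ι (suc i ^ k) ℚ.* (1-e⁻ˣ ^S i) n))
    ≡⟨ Q.Σ≤-cong n expand ⟩
  Q.Σ≤ n (λ i → Q.Σ≤ n (λ m → P n i ℚ.* ι (i C m) ℚ.* ι (T 0 k m)))
    ≡⟨ Q.Σ≤-swap n n _ ⟩
  Q.Σ≤ n (λ m → Q.Σ≤ n (λ i → P n i ℚ.* ι (i C m) ℚ.* ι (T 0 k m)))
    ≡⟨ Q.Σ≤-cong n (λ m _ → trans (Q.Σ≤-*ʳ n (ι (T 0 k m)) _) (cong (ℚ._* ι (T 0 k m)) (P-binomial n m))) ⟩
  Q.Σ≤ n (λ m → ι (T 0 n m) ℚ.* ι (T 0 k m))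
    ≡⟨ Q.Σ≤-cong n (λ m _ → ι-* (T 0 n m) (T 0 k m)) ⟨
  Q.Σ≤ n (λ m → ι (T 0 n m * T 0 k m))
    ≡⟨ ι-Σ≤ n _ ⟨
  ι (Σ≤ n (λ m → T 0 n m * T 0 k m)) ∎
  where
  expand : ∀ i → i ≤ n → ι (n !) ℚ.* (ι (suc i ^ k) ℚ.* (1-e⁻ˣ ^S i) n)
           ≡ Q.Σ≤ n (λ m → P n i ℚ.* ι (i C m) ℚ.* ι (T 0 k m))
  expand i i≤n = begin
    ι (n !) ℚ.* (ι (suc i ^ k) ℚ.* (1-e⁻ˣ ^S i) n)
      ≡⟨ *-swapʳ (ι (n !)) (ι (suc i ^ k)) ((1-e⁻ˣ ^S i) n) ⟩
    P n i ℚ.* ι (suc i ^ k)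
      ≡⟨ cong (λ x → P n i ℚ.* ι x) (power-T n i k i≤n) ⟩
    P n i ℚ.* ι (Σ≤ n (λ m → (i C m) * T 0 k m))
      ≡⟨ cong (P n i ℚ.*_) (ι-Σ≤ n _) ⟩
    P n i ℚ.* Q.Σ≤ n (λ m → ι ((i C m) * T 0 k m))
      ≡⟨ Q.Σ≤-*ˡ n (P n i) _ ⟨
    Q.Σ≤ n (λ m → P n i ℚ.* ι ((i C m) * T 0 k m))
      ≡⟨ Q.Σ≤-cong n (λ m _ → trans (cong (P n i ℚ.*_) (ι-* (i C m) (T 0 k m))) (sym (ℚ.*-assoc (P n i) _ _))) ⟩
    Q.Σ≤ n (λ m → P n i ℚ.* ι (i C m) ℚ.* ι (T 0 k m)) ∎

open import Data.Integer using (+_)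

theorem4 : (n k : ℕ) → n > 0 → k > 0 →
    (numCallan n k ≡ eulerianSum n k) × ((+ numCallan n k) / 1 ≡ B n k)
theorem4 n k n>0 k>0 =
  trans (numCallan-T n k) (sym (eulerianSum-T n k n>0 k>0)) ,
  -- The expansion of `B n k` runs up to `n`; the terms with `n ⊓ k < m` vanish.
  trans (cong ι (trans (numCallan-T n k) (Σ≤-extend (n ⊓ k) n (m⊓n≤m n k) (T-product-vanish n k))))
        (sym (polyBernoulli-T n k))
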